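{- Let $C\ge1$ and $\rho_0\in(0,1)$ be constants, and let $s:\mathbb N\to\mathbb N$ satisfy $s(d)=o(d\log d)$. Then for all sufficiently large $d$, for every outlier chance $\rho\in[\rho_0,1]$ and every probability distribution $\mathcal D$ on tuples $x=(x_1,\dots,x_{s(d)})\in[-1,1]^{s(d)}$, there is no (possibly randomized) algorithm for robust polynomial regression with points $x\sim\mathcal D$ and independent outlier chance $\rho$ that achieves a $C$-approximation in $\ell_\infty$ norm with failure probability at most $1/4$. That is, for every algorithm mapping samples $(x_i,y_i)_{i\le s(d)}$ to a function $\widehat p:[-1,1]\to\mathbb R$ there exist a real polynomial $p$ of degree at most $d$, a noise level $\sigma>0$, and an adversary such that $\Pr\left[\|\widehat p-p\|_\infty>C\sigma\right]>\tfrac14$.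
   Context: $\|f\|_\infty=\sup_{x\in[-1,1]}|f(x)|$. Robust polynomial regression with outlier chance $\rho$: there is an unknown real polynomial $p$ of degree at most $d$ and a noise level $\sigma$. The points $x=(x_1,\dots,x_s)$ are drawn from $\mathcal D$; each index $i$ is an outlier independently with probability $\rho$ (independently of $x$). A (possibly randomized) adversary, seeing $p$, the points and the set of outliers, then picks $y_i\in\mathbb R$ subject only to $|y_i-p(x_i)|\le\sigma$ for each non-outlier $i$. The algorithm sees only the samples $(x_i,y_i)$; it may know $d,C,\rho,\sigma,\mathcal D$. The probability is over the points, the outlier set, and any randomness of the adversary and algorithm. -}

module Defs where

open import Algebra.Bundles using (CommutativeRing; Semiring)
open import Algebra.Core using (Op₁; Op₂)
import Algebra.Definitions.RawSemiring as RawSemiringDefinitions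
open import Algebra.Structures using (IsCommutativeRing)
open import Data.Bool.Base using (if_then_else_)
open import Data.Fin.Base using (Fin; toℕ)
open import Data.Fin.Subset using (Subset; _∉_)
open import Data.Nat.Base as ℕ using (ℕ; suc)
open import Data.Product.Base using (Σ-syntax; ∃-syntax; _×_; _,_)
open import Data.Refinement using (Refinement-syntax; value)
open import Data.Sum.Base using (inj₁; inj₂)
open import Data.Unit.Base using (⊤)
open import Data.Vec.Base using (Vec; []; _∷_; lookup; map)
open import Function.Base using (id)
open import Level using (Level; 0ℓ; _⊔_) renaming (suc to lsuc)
open import Relation.Binary.Core using (Rel)
import Relation.Binary.Construct.Add.Supremum.NonStrict as AddSupremumNonStrict
import Relation.Binary.Construct.Add.Supremum.Strict as AddSupremumStrict
import Relation.Binary.Construct.NonStrictToStrict as NonStrictToStrict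
open import Relation.Binary.PropositionalEquality.Core using (_≡_; _≢_)
open import Relation.Binary.Structures using (IsTotalOrder)
open import Relation.Nullary.Construct.Add.Supremum using (_⁺; [_])
open import Relation.Unary using (Pred; Satisfiable; U; ∁; ⋃; _≐_; _⊢_; _⟨×⟩_)
  renaming (_⊥_ to Disjoint)

private
  variable
    a b ℓ : Level
    A B : Set a
    n : ℕ

IsUpperBound : Rel A ℓ → Pred A b → A → Set _
IsUpperBound _≤_ P u = ∀ r → P r → r ≤ u

record IsLub {A : Set a} (_≤_ : Rel A ℓ) (P : Pred A b) (u : A) : Set (a ⊔ b ⊔ ℓ) where
  field
    upper : IsUpperBound _≤_ P u
    least : ∀ v → IsUpperBound _≤_ P v → u ≤ v

-- The real numbers, characterised (uniquely up to isomorphism, given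
-- excluded middle) as a Dedekind-complete totally ordered field.  The value
-- of 0# ⁻¹ is unspecified.
record CompleteOrderedField : Set₁ where
  infix  4 _≤_
  infix  8 -_ _⁻¹
  infixl 7 _*_
  infixl 6 _+_
  field
    Carrier           : Set
    _≤_               : Rel Carrier 0ℓ
    _+_ _*_           : Op₂ Carrier
    -_ _⁻¹            : Op₁ Carrier
    0# 1#             : Carrier
    isCommutativeRing : IsCommutativeRing _≡_ _+_ _*_ -_ 0# 1#
    isTotalOrder      : IsTotalOrder _≡_ _≤_
    1≢0               : 1# ≢ 0#
    *-inverseʳ        : ∀ x → x ≢ 0# → x * x ⁻¹ ≡ 1#
    +-monoˡ-≤         : ∀ x y z → x ≤ y → x + z ≤ y + z
    *-nonNegative     : ∀ x y → 0# ≤ x → 0# ≤ y → 0# ≤ x * y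
    complete          : (P : Pred Carrier 0ℓ) → Satisfiable P →
                        (∃[ v ] IsUpperBound _≤_ P v) → ∃[ u ] IsLub _≤_ P u

  commutativeRing : CommutativeRing 0ℓ 0ℓ
  commutativeRing = record { isCommutativeRing = isCommutativeRing }

  open CommutativeRing commutativeRing public using (_-_; semiring)
  open IsTotalOrder isTotalOrder public using (total)
  open NonStrictToStrict _≡_ _≤_ public using (_<_)
  open RawSemiringDefinitions (Semiring.rawSemiring semiring) public using (sum; product)
    renaming (_×_ to _·_)

  fromℕ : ℕ → Carrier
  fromℕ n = n · 1#

  ∣_∣ : Op₁ Carrier
  ∣ x ∣ with total 0# x
  ... | inj₁ _ = x
  ... | inj₂ _ = - x

-- Propositions are types, so σ-algebras are closed under extensional
-- equality of predicates.
record MeasurableSpace : Set₂ where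
  field
    Carrier      : Set
    IsMeasurable : Pred (Pred Carrier 0ℓ) (lsuc 0ℓ)
    whole        : IsMeasurable U
    complement   : ∀ {P} → IsMeasurable P → IsMeasurable (∁ P)
    union        : (P : ℕ → Pred Carrier 0ℓ) →
                   (∀ k → IsMeasurable (P k)) → IsMeasurable (⋃ ℕ P)
    resp         : ∀ {P Q} → P ≐ Q → IsMeasurable P → IsMeasurable Q

open MeasurableSpace using (IsMeasurable)

Points : MeasurableSpace → Set
Points = MeasurableSpace.Carrier

MeasurableMap : (M N : MeasurableSpace) → (Points M → Points N) → Set₁
MeasurableMap M N f = ∀ Q → IsMeasurable N Q → IsMeasurable M (f ⊢ Q)

data Generated {A : Set} (G : Pred (Pred A 0ℓ) (lsuc 0ℓ)) :
               Pred (Pred A 0ℓ) (lsuc 0ℓ) where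
  basic      : ∀ {P} → G P → Generated G P
  whole      : Generated G U
  complement : ∀ {P} → Generated G P → Generated G (∁ P)
  union      : (P : ℕ → Pred A 0ℓ) → (∀ k → Generated G (P k)) → Generated G (⋃ ℕ P)
  resp       : ∀ {P Q} → P ≐ Q → Generated G P → Generated G Q

generated : {A : Set} → Pred (Pred A 0ℓ) (lsuc 0ℓ) → MeasurableSpace
generated {A} G = record
  { Carrier      = A
  ; IsMeasurable = Generated G
  ; whole        = whole
  ; complement   = complement
  ; union        = union
  ; resp         = resp
  }

discrete : Set → MeasurableSpace
discrete A = record
  { Carrier      = A
  ; IsMeasurable = λ _ → Level.Lift _ ⊤
  ; whole        = _
  ; complement   = _
  ; union        = _
  ; resp         = _
  }

infixr 2 _⊗_
_⊗_ : MeasurableSpace → MeasurableSpace → MeasurableSpace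
M ⊗ N = generated {Points M × Points N} λ R →
  Σ[ P ∈ Pred (Points M) 0ℓ ] Σ[ Q ∈ Pred (Points N) 0ℓ ]
    IsMeasurable M P × IsMeasurable N Q × (R ≡ (P ⟨×⟩ Q))

module Regression (R : CompleteOrderedField) where
  open CompleteOrderedField R renaming (Carrier to ℝ)
  open AddSupremumNonStrict _≤_ using (_≤⁺_)
  open AddSupremumStrict _<_ using (_<⁺_)

  record ProbabilityMeasure (M : MeasurableSpace) : Set₁ where
    -- Only the values of pr on measurable sets are meaningful.
    field
      pr         : Pred (Points M) 0ℓ → ℝ
      pr-cong    : ∀ {P Q} → P ≐ Q → IsMeasurable M P → pr P ≡ pr Q
      pr-nonNeg  : ∀ {P} → IsMeasurable M P → 0# ≤ pr P
      pr-whole   : pr U ≡ 1#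
      pr-union   : (P : ℕ → Pred (Points M) 0ℓ) → (∀ k → IsMeasurable M (P k)) →
                   (∀ i j → i ≢ j → Disjoint (P i) (P j)) →
                   IsLub _≤_ (λ r → ∃[ n ] r ≡ sum {n} (λ k → pr (P (toℕ k))))
                         (pr (⋃ ℕ P))

  open ProbabilityMeasure public using (pr)

  -- Topology and Borel σ-algebra induced by real coordinates.
  IsOpen : {A : Set} → (A → Vec ℝ n) → Pred (Pred A 0ℓ) 0ℓ
  IsOpen coord P = ∀ x → P x → ∃[ r ] 0# < r ×
    (∀ y → (∀ i → ∣ lookup (coord y) i - lookup (coord x) i ∣ < r) → P y)

  borel : {A : Set} → (A → Vec ℝ n) → MeasurableSpace
  borel coord = generated λ P → Level.Lift _ (IsOpen coord P)

  [-1,1] : Set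
  [-1,1] = [ t ∈ ℝ ∣ (- 1# ≤ t) × (t ≤ 1#) ]

  Cube : ℕ → MeasurableSpace
  Cube n = borel {n} {Vec [-1,1] n} (map value)

  Space : ℕ → MeasurableSpace
  Space n = borel {n} {Vec ℝ n} id

  -- ‖ f ‖∞≡ N : the supremum of |f| over [-1,1], taken in ℝ ∪ {∞}, is N.
  ‖_‖∞≡_ : ([-1,1] → ℝ) → ℝ ⁺ → Set
  ‖ f ‖∞≡ N = IsLub _≤⁺_ (λ r → ∃[ t ] r ≡ [ ∣ f t ∣ ]) N

  _<‖_‖∞ : ℝ → ([-1,1] → ℝ) → Set
  c <‖ f ‖∞ = ∃[ N ] (‖ f ‖∞≡ N) × ([ c ] <⁺ N)

  -- Real polynomials of degree at most d; constant coefficient first.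
  Poly : ℕ → Set
  Poly d = Vec ℝ (suc d)

  eval : Vec ℝ n → ℝ → ℝ
  eval []       t = 0#
  eval (c ∷ cs) t = c + t * eval cs t

  error : ∀ {d} → ([-1,1] → ℝ) → Poly d → [-1,1] → ℝ
  error p̂ p t = p̂ t - eval p (value t)

  -- The first argument of estimate is the noise level, which the algorithm is
  -- allowed to know.  All other known quantities are fixed before the algorithm.
  record Algorithm (d n : ℕ) : Set₂ where
    field
      Seed       : MeasurableSpace
      seedLaw    : ProbabilityMeasure Seed
      estimate   : ℝ → Vec [-1,1] n → Vec ℝ n → Points Seed → [-1,1] → ℝ
      measurable : ∀ σ (p : Poly d) c →
                   IsMeasurable (Cube n ⊗ Space n ⊗ Seed)
                     (λ (x , y , u) → c <‖ error (estimate σ x y u) p ‖∞)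

  record Adversary {d : ℕ} (n : ℕ) (p : Poly d) (σ : ℝ) : Set₂ where
    field
      Seed       : MeasurableSpace
      seedLaw    : ProbabilityMeasure Seed
      respond    : Vec [-1,1] n → Subset n → Points Seed → Vec ℝ n
      bounded    : ∀ x S v i → i ∉ S →
                   ∣ lookup (respond x S v) i - eval p (value (lookup x i)) ∣ ≤ σ
      measurable : MeasurableMap (Cube n ⊗ discrete (Subset n) ⊗ Seed) (Space n)
                     (λ (x , S , v) → respond x S v)

  -- Probability that the outlier set is exactly S.
  outlierWeight : ℝ → Subset n → ℝ
  outlierWeight ρ S = product λ i → if lookup S i then ρ else 1# - ρ

  module _ {d n : ℕ} {p : Poly d} {σ : ℝ}
           (alg : Algorithm d n) (adv : Adversary n p σ) where
    private
      module Alg = Algorithm alg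
      module Adv = Adversary adv

    Outcomes : MeasurableSpace
    Outcomes = Cube n ⊗ discrete (Subset n) ⊗ Alg.Seed ⊗ Adv.Seed

    -- The points, the outlier set and the two seeds are independent; the
    -- values on these rectangles determine the measure on Outcomes.
    IsJointLaw : ℝ → ProbabilityMeasure (Cube n) → ProbabilityMeasure Outcomes → Set₁
    IsJointLaw ρ 𝒟 ℙ = ∀ P S Q T →
      IsMeasurable (Cube n) P → IsMeasurable Alg.Seed Q → IsMeasurable Adv.Seed T →
      pr ℙ (P ⟨×⟩ (S ≡_) ⟨×⟩ Q ⟨×⟩ T)
        ≡ pr 𝒟 P * (outlierWeight ρ S * (pr Alg.seedLaw Q * pr Adv.seedLaw T))

    Failure : ℝ → Pred (Points Outcomes) 0ℓ
    Failure C (x , S , u , v) =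
      (C * σ) <‖ error (Alg.estimate σ x (Adv.respond x S v) u) p ‖∞

  -- The binary logarithm as a Dedekind supremum of rationals:
  -- a / b ≤ log₂ m exactly when 2 ^ a ≤ m ^ b.
  IsLog₂ : ℕ → ℝ → Set
  IsLog₂ m = IsLub _≤_ λ r → ∃[ a ] ∃[ b ]
    (2 ℕ.^ a ℕ.≤ m ℕ.^ suc b) × (r ≡ fromℕ a * fromℕ (suc b) ⁻¹)

  -- s(d) = o(d log d); the base of the logarithm is immaterial.
  IsLittleO-dlogd : (ℕ → ℕ) → Set
  IsLittleO-dlogd s = ∀ ε → 0# < ε → ∃[ N ] (∀ d → N ℕ.≤ d →
    ∃[ L ] IsLog₂ d L × (fromℕ (s d) ≤ ε * (fromℕ d * L)))

{-# OPTIONS --safe #-}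
module Submission where

-- Cut [-1,1] into m = Θ(d) equal blocks.  A Chebyshev polynomial composed with a quadratic gives, for each block j,
-- a polynomial q j of degree at most d that is at most 1 in absolute value outside block j and exceeds 2C at its
-- centre.  For ε ∈ {0,1}^m let p_ε be the sum of the q j with ε j = 1, and let the noise level be 1.  If all samples
-- in some block j are outliers, the adversary answers with the values of p_ε with ε j replaced by 0; the answers
-- then do not depend on ε j, while changing ε j moves p_ε by more than 2C, so the algorithm fails for at least half of
-- all ε.  With c j samples in block j, no block is exposed with probability ∏ (1 - ρ^(c j)) ≤ 1 / (1 + ∑ ρ^(c j)),
-- and this is at most 1/3 because s(d) = o(d log d).  Averaged over ε the failure probability is therefore at least
-- 1/3, so some ε works.

open import Axiom.ExcludedMiddle using (ExcludedMiddle)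
open import Data.Nat.Base as ℕ using (ℕ; zero; suc; NonZero)
open import Data.Product.Base using (∃-syntax; Σ-syntax; _×_; _,_; proj₁; proj₂)
open import Defs

open import Algebra.Bundles using (CommutativeRing)
import Algebra.Properties.AbelianGroup as AbelianGroupProperties
import Algebra.Properties.Ring as RingProperties
import Algebra.Properties.Semiring.Exp as Exp
import Algebra.Properties.Semiring.Mult as MultProperties
import Algebra.Properties.Semiring.Mult.TCOptimised as MultOptimised
import Algebra.Solver.Ring as RingSolver
open import Algebra.Solver.Ring.AlmostCommutativeRing using (fromCommutativeRing; _-Raw-AlmostCommutative⟶_)
open import Data.Bool.Base using (Bool; true; false; if_then_else_)
open import Data.Empty using (⊥; ⊥-elim)
open import Data.Fin.Base using (Fin; zero; suc; toℕ)
import Data.Fin.Properties as Fin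
open import Data.Fin.Subset using (Subset; _∉_)
open import Data.Integer.Base as ℤ using (ℤ; -[1+_]) renaming (+_ to ⁺_)
import Data.Integer.Properties as ℤ
open import Data.Irrelevant using ([_])
open import Data.List.Base as List using (List; []; _∷_; _++_; cartesianProductWith)
open import Data.List.Membership.Propositional using (_∈_; lose)
open import Data.List.Membership.Propositional.Properties using (∈-cartesianProductWith⁺; ∈-map⁺; ∈-allFin)
open import Data.List.Relation.Unary.Any using (Any; here; there; satisfied)
open import Data.Maybe.Base as Maybe using (Maybe; just; nothing)
open import Data.Nat.DivMod using (_/_; m≡m%n+[m/n]*n; m%n<n; m/n*n≤m)
import Data.Nat.Properties as ℕ
open import Data.Nat.Tactic.RingSolver using (solve-∀)
open import Data.Refinement using (value; _,_)
open import Data.Sum.Base using (_⊎_; inj₁; inj₂; [_,_]′)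
open import Data.Unit.Base using (tt)
open import Data.Vec.Base as Vec using (Vec; []; _∷_; lookup; replicate; updateAt; zipWith; _[_]≔_)
open import Data.Vec.Properties
  using (lookup-map; lookup⇒[]=; lookup∘update; lookup∘update′; []≔-idempotent; []≔-lookup; tabulate∘lookup; tabulate-cong)
open import Function.Base using (_∘_; id)
open import Level using (0ℓ; lift) renaming (suc to lsuc)
open import Relation.Binary.Bundles using (Poset; TotalOrder)
import Relation.Binary.Construct.Add.Supremum.NonStrict as AddSupremumNonStrict
import Relation.Binary.Construct.Add.Supremum.Strict as AddSupremumStrict
open import Relation.Binary.Definitions using (tri<; tri≈; tri>)
open import Relation.Binary.PropositionalEquality
  using (_≡_; _≢_; refl; sym; trans; cong; cong₂; subst; subst₂; module ≡-Reasoning)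
import Relation.Binary.Reasoning.PartialOrder as PosetReasoning
open import Relation.Binary.Structures using (IsTotalOrder)
open import Relation.Nullary using (¬_; Dec; yes; no; does; contradiction)
open import Relation.Nullary.Construct.Add.Supremum using ([_]; ⊤⁺)
open import Relation.Nullary.Decidable using (dec⇒maybe; decidable-stable; recompute)
open import Relation.Unary using (Pred; U; ∁; ∅; ⋃; _∪_; _∩_; _≐_; _⊢_; _⟨×⟩_) renaming (_⊥_ to Disjoint)

-- A non-outlier lies outside every exposed block, where each peak is bounded only by 1. Hiding
-- several bits at once could push the deviation beyond the noise level 1, so just the first exposed
-- block is hidden. A Chebyshev polynomial of degree k gains at least k²h at distance h beyond 1,
-- and the quadratic puts the centre of a block at distance of order 1/m² there. Degree of order m
-- thus suffices for a peak of fixed height, which permits linearly many blocks. With K of order log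
-- d, a block of at most K samples is exposed with probability at least of order d^(-1/2), so Θ(d)
-- blocks make exposure of some block likely. The averaging over ε mixes different adversaries,
-- hence a priori different measures, and a joint law is prescribed on rectangles only. All the
-- adversaries share one seed space, so their laws live on a single space, where a π-λ argument
-- identifies them. Expectations occur only as finite combinations of indicators.

-- Ordered field arithmetic and a ring solver.

module RealField (em : ∀ ℓ → ExcludedMiddle ℓ) (R : CompleteOrderedField) where
  open CompleteOrderedField R renaming (Carrier to ℝ) public
  open CommutativeRing commutativeRing public
    using (+-comm; +-assoc; +-identityˡ; +-identityʳ; -‿inverseʳ; -‿inverseˡ;
           *-comm; *-assoc; *-identityˡ; *-identityʳ; zeroˡ; zeroʳ; distribˡ; ring; +-abelianGroup)
  open IsTotalOrder isTotalOrder public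
    using () renaming (refl to ≤-refl; reflexive to ≤-reflexive; trans to ≤-trans; antisym to ≤-antisym)
  open MultProperties semiring public using () renaming (×-homo-+ to ·-homo-+; ×1-homo-* to fromℕ-*)

  poset : Poset 0ℓ 0ℓ 0ℓ
  poset = TotalOrder.poset (record { isTotalOrder = isTotalOrder })

  module ≤-Reasoning = PosetReasoning poset

  -- Integer coefficients are interpreted by the optimised multiple, for which the numerals 0 and 1
  -- denote `0#` and `1#` definitionally; solved equations then match goals written with these
  -- constants.
  module Solver where
    private
      module Opt = MultOptimised semiring
      module RP = RingProperties ring
      module AP = AbelianGroupProperties +-abelianGroup

      ⟦_⟧ℤ : ℤ → ℝ
      ⟦ ⁺ n ⟧ℤ      = n Opt.× 1#
      ⟦ -[1+ n ] ⟧ℤ = - (suc n Opt.× 1#)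

      pos : ∀ n → ⟦ ⁺ n ⟧ℤ ≡ fromℕ n
      pos n = sym (Opt.×ᵤ≈× n 1#)

      neg-homo : ∀ i → ⟦ ℤ.- i ⟧ℤ ≡ - ⟦ i ⟧ℤ
      neg-homo (⁺ zero)  = sym RP.-0#≈0#
      neg-homo (⁺ suc n) = refl
      neg-homo -[1+ n ]  = sym (RP.-‿involutive _)

      ⊖-homo : ∀ m n → ⟦ m ℤ.⊖ n ⟧ℤ ≡ fromℕ m - fromℕ n
      ⊖-homo m       zero    = trans (pos m) (sym (trans (cong (fromℕ m +_) RP.-0#≈0#) (+-identityʳ _)))
      ⊖-homo zero    (suc n) = trans (cong -_ (pos (suc n))) (sym (+-identityˡ _))
      ⊖-homo (suc m) (suc n) = begin
        ⟦ suc m ℤ.⊖ suc n ⟧ℤ                 ≡⟨ cong ⟦_⟧ℤ (ℤ.[1+m]⊖[1+n]≡m⊖n m n) ⟩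
        ⟦ m ℤ.⊖ n ⟧ℤ                         ≡⟨ ⊖-homo m n ⟩
        fromℕ m - fromℕ n                    ≡⟨ cong (_- fromℕ n) (sym (+-identityˡ _)) ⟩
        (0# + fromℕ m) - fromℕ n             ≡⟨ cong (λ z → (z + fromℕ m) - fromℕ n) (sym (-‿inverseˡ 1#)) ⟩
        (- 1# + 1# + fromℕ m) - fromℕ n      ≡⟨ cong (_- fromℕ n) (+-assoc _ _ _) ⟩
        (- 1# + fromℕ (suc m)) - fromℕ n     ≡⟨ cong (_- fromℕ n) (+-comm _ _) ⟩
        (fromℕ (suc m) - 1#) - fromℕ n       ≡⟨ +-assoc _ _ _ ⟩
        fromℕ (suc m) + (- 1# - fromℕ n)     ≡⟨ cong (fromℕ (suc m) +_) (AP.⁻¹-∙-comm 1# (fromℕ n)) ⟩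
        fromℕ (suc m) - fromℕ (suc n)        ∎
        where open ≡-Reasoning

      +-homo : ∀ i j → ⟦ i ℤ.+ j ⟧ℤ ≡ ⟦ i ⟧ℤ + ⟦ j ⟧ℤ
      +-homo (⁺ m)    (⁺ n)    = Opt.×-homo-+ 1# m n
      +-homo (⁺ m)    -[1+ n ] = trans (⊖-homo m (suc n)) (sym (cong₂ (λ x y → x - y) (pos m) (pos (suc n))))
      +-homo -[1+ m ] (⁺ n)    = trans (⊖-homo n (suc m))
        (trans (sym (cong₂ (λ x y → x - y) (pos n) (pos (suc m)))) (+-comm _ _))
      +-homo -[1+ m ] -[1+ n ] = trans (cong (λ k → - (k Opt.× 1#)) (cong suc (sym (ℕ.+-suc m n))))
        (trans (cong -_ (Opt.×-homo-+ 1# (suc m) (suc n))) (sym (AP.⁻¹-∙-comm _ _)))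

      *-homo⁺ : ∀ m j → ⟦ ⁺ m ℤ.* j ⟧ℤ ≡ ⟦ ⁺ m ⟧ℤ * ⟦ j ⟧ℤ
      *-homo⁺ m (⁺ n) = begin
        ⟦ ⁺ m ℤ.* ⁺ n ⟧ℤ       ≡⟨ cong ⟦_⟧ℤ (sym (ℤ.pos-* m n)) ⟩
        ⟦ ⁺ (m ℕ.* n) ⟧ℤ       ≡⟨ Opt.×1-homo-* m n ⟩
        ⟦ ⁺ m ⟧ℤ * ⟦ ⁺ n ⟧ℤ    ∎
        where open ≡-Reasoning
      *-homo⁺ m -[1+ n ] = begin
        ⟦ ⁺ m ℤ.* -[1+ n ] ⟧ℤ             ≡⟨ cong ⟦_⟧ℤ (sym (ℤ.neg-distribʳ-* (⁺ m) (⁺ suc n))) ⟩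
        ⟦ ℤ.- (⁺ m ℤ.* ⁺ suc n) ⟧ℤ        ≡⟨ neg-homo (⁺ m ℤ.* ⁺ suc n) ⟩
        - ⟦ ⁺ m ℤ.* ⁺ suc n ⟧ℤ            ≡⟨ cong -_ (*-homo⁺ m (⁺ suc n)) ⟩
        - (⟦ ⁺ m ⟧ℤ * ⟦ ⁺ suc n ⟧ℤ)       ≡⟨ RP.-‿distribʳ-* _ _ ⟩
        ⟦ ⁺ m ⟧ℤ * ⟦ -[1+ n ] ⟧ℤ          ∎
        where open ≡-Reasoning

      *-homo : ∀ i j → ⟦ i ℤ.* j ⟧ℤ ≡ ⟦ i ⟧ℤ * ⟦ j ⟧ℤ
      *-homo (⁺ m)    j = *-homo⁺ m j
      *-homo -[1+ m ] j = begin
        ⟦ -[1+ m ] ℤ.* j ⟧ℤ          ≡⟨ cong ⟦_⟧ℤ (sym (ℤ.neg-distribˡ-* (⁺ suc m) j)) ⟩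
        ⟦ ℤ.- (⁺ suc m ℤ.* j) ⟧ℤ     ≡⟨ neg-homo (⁺ suc m ℤ.* j) ⟩
        - ⟦ ⁺ suc m ℤ.* j ⟧ℤ         ≡⟨ cong -_ (*-homo⁺ (suc m) j) ⟩
        - (⟦ ⁺ suc m ⟧ℤ * ⟦ j ⟧ℤ)    ≡⟨ RP.-‿distribˡ-* _ _ ⟩
        ⟦ -[1+ m ] ⟧ℤ * ⟦ j ⟧ℤ       ∎
        where open ≡-Reasoning

      homomorphism : ℤ.+-*-rawRing -Raw-AlmostCommutative⟶ fromCommutativeRing commutativeRing
      homomorphism = record
        { ⟦_⟧    = ⟦_⟧ℤ
        ; +-homo = +-homo
        ; *-homo = *-homo
        ; -‿homo = neg-homo
        ; 0-homo = refl
        ; 1-homo = refl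
        }

    open RingSolver ℤ.+-*-rawRing (fromCommutativeRing commutativeRing) homomorphism
      (λ i j → Maybe.map (cong ⟦_⟧ℤ) (dec⇒maybe (i ℤ.≟ j)))
      public using (Polynomial; solve; _:=_; _:+_; _:*_; _:-_; :-_; con)

  open Solver

  :0 :1 : ∀ {n} → Polynomial n
  :0 {n} = con (⁺ 0)
  :1 {n} = con (⁺ 1)

  ≤-diff : ∀ {x y} → 0# ≤ y - x → x ≤ y
  ≤-diff {x} {y} p = subst₂ _≤_ (+-identityˡ x)
    (solve 2 (λ x y → y :- x :+ x := y) refl x y) (+-monoˡ-≤ 0# (y - x) x p)

  diff-≤ : ∀ {x y} → x ≤ y → 0# ≤ y - x
  diff-≤ {x} {y} p = subst (_≤ y - x) (-‿inverseʳ x) (+-monoˡ-≤ x y (- x) p)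

  +-mono-≤ : ∀ {a b c d} → a ≤ b → c ≤ d → a + c ≤ b + d
  +-mono-≤ {a} {b} {c} {d} p q = ≤-trans (+-monoˡ-≤ a b c p)
    (subst₂ _≤_ (+-comm c b) (+-comm d b) (+-monoˡ-≤ c d b q))

  +-nonNeg : ∀ {x y} → 0# ≤ x → 0# ≤ y → 0# ≤ x + y
  +-nonNeg p q = subst (_≤ _) (+-identityʳ 0#) (+-mono-≤ p q)

  *-monoˡ-≤ : ∀ z {x y} → 0# ≤ z → x ≤ y → z * x ≤ z * y
  *-monoˡ-≤ z {x} {y} p q = ≤-diff (subst (0# ≤_)
    (solve 3 (λ x y z → z :* (y :- x) := z :* y :- z :* x) refl x y z) (*-nonNegative z (y - x) p (diff-≤ q)))

  *-monoʳ-≤ : ∀ z {x y} → 0# ≤ z → x ≤ y → x * z ≤ y * z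
  *-monoʳ-≤ z p q = subst₂ _≤_ (*-comm z _) (*-comm z _) (*-monoˡ-≤ z p q)

  *-mono-≤ : ∀ {a b c d} → 0# ≤ b → 0# ≤ c → a ≤ b → c ≤ d → a * c ≤ b * d
  *-mono-≤ {b = b} {c} 0≤b 0≤c p q = ≤-trans (*-monoʳ-≤ c 0≤c p) (*-monoˡ-≤ b 0≤b q)

  neg-mono-≤ : ∀ {x y} → x ≤ y → - y ≤ - x
  neg-mono-≤ {x} {y} p = ≤-diff (subst (0# ≤_)
    (solve 2 (λ x y → y :- x := (:- x) :- (:- y)) refl x y) (diff-≤ p))

  0≤-neg : ∀ {x} → x ≤ 0# → 0# ≤ - x
  0≤-neg {x} p = subst (0# ≤_) (+-identityˡ (- x)) (diff-≤ p)

  square-nonNeg : ∀ x → 0# ≤ x * x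
  square-nonNeg x with total 0# x
  ... | inj₁ p = *-nonNegative x x p p
  ... | inj₂ p = subst (0# ≤_) (solve 1 (λ x → (:- x) :* (:- x) := x :* x) refl x)
                   (*-nonNegative (- x) (- x) (0≤-neg p) (0≤-neg p))

  0≤1 : 0# ≤ 1#
  0≤1 = subst (0# ≤_) (*-identityˡ 1#) (square-nonNeg 1#)

  0<1 : 0# < 1#
  0<1 = 0≤1 , λ eq → 1≢0 (sym eq)

  ≰⇒> : ∀ {x y} → ¬ (x ≤ y) → y < x
  ≰⇒> {x} {y} ¬p with total x y
  ... | inj₁ p = contradiction p ¬p
  ... | inj₂ q = q , λ eq → ¬p (≤-reflexive (sym eq))

  <⇒≱ : ∀ {x y} → x < y → ¬ (y ≤ x)
  <⇒≱ (p , x≢y) q = x≢y (≤-antisym p q)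

  <-≤-trans : ∀ {x y z} → x < y → y ≤ z → x < z
  <-≤-trans p q = ≰⇒> λ r → <⇒≱ p (≤-trans q r)

  ≤-<-trans : ∀ {x y z} → x ≤ y → y < z → x < z
  ≤-<-trans p q = ≰⇒> λ r → <⇒≱ q (≤-trans r p)

  ≮⇒≥ : ∀ {x y} → ¬ (x < y) → y ≤ x
  ≮⇒≥ {x} {y} ¬p with total x y
  ... | inj₂ q = q
  ... | inj₁ p with em 0ℓ {x ≡ y}
  ...   | yes eq = ≤-reflexive (sym eq)
  ...   | no x≢y = contradiction (p , x≢y) ¬p

  <-diff : ∀ {x y} → 0# < y - x → x < y
  <-diff (p , ne) = ≤-diff p , λ { refl → ne (sym (-‿inverseʳ _)) }

  diff-< : ∀ {x y} → x < y → 0# < y - x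
  diff-< {x} {y} (p , ne) = diff-≤ p , λ eq → ne (sym (trans (solve 2 (λ x y → y := y :- x :+ x) refl x y)
    (trans (cong (_+ x) (sym eq)) (+-identityˡ x))))

  +-pos-nonNeg : ∀ {x y} → 0# < x → 0# ≤ y → 0# < x + y
  +-pos-nonNeg {x} {y} p q = <-≤-trans p (subst (_≤ x + y) (+-identityʳ x) (+-mono-≤ ≤-refl q))

  *-cancelˡ-0 : ∀ {x y} → x ≢ 0# → x * y ≡ 0# → y ≡ 0#
  *-cancelˡ-0 {x} {y} ne eq = begin
    y                ≡⟨ sym (*-identityˡ y) ⟩
    1# * y           ≡⟨ cong (_* y) (sym (*-inverseʳ x ne)) ⟩
    x * x ⁻¹ * y     ≡⟨ solve 3 (λ x z y → x :* z :* y := z :* (x :* y)) refl x (x ⁻¹) y ⟩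
    x ⁻¹ * (x * y)   ≡⟨ cong (x ⁻¹ *_) eq ⟩
    x ⁻¹ * 0#        ≡⟨ zeroʳ _ ⟩
    0#               ∎
    where open ≡-Reasoning

  *-pos : ∀ {x y} → 0# < x → 0# < y → 0# < x * y
  *-pos (p , x≢) (q , y≢) = *-nonNegative _ _ p q ,
    λ eq → y≢ (sym (*-cancelˡ-0 (λ e → x≢ (sym e)) (sym eq)))

  *-cancelˡ-≤ : ∀ {x y z} → 0# < z → z * x ≤ z * y → x ≤ y
  *-cancelˡ-≤ {x} {y} {z} 0<z p = ≮⇒≥ λ y<x → <⇒≱
    (<-diff (subst (0# <_) (solve 3 (λ x y z → z :* (x :- y) := z :* x :- z :* y) refl x y z) (*-pos 0<z (diff-< y<x)))) p

  *-monoˡ-< : ∀ {x y z} → 0# < z → x < y → z * x < z * y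
  *-monoˡ-< {x} {y} {z} 0<z p = ≰⇒> λ q → <⇒≱ p (*-cancelˡ-≤ 0<z q)

  *-cancelˡ-< : ∀ {x y z} → 0# ≤ z → z * x < z * y → x < y
  *-cancelˡ-< 0≤z p = ≰⇒> λ q → <⇒≱ p (*-monoˡ-≤ _ 0≤z q)

  ⁻¹-inverse : ∀ {x} → 0# < x → x * x ⁻¹ ≡ 1#
  ⁻¹-inverse (_ , ne) = *-inverseʳ _ λ e → ne (sym e)

  ⁻¹-pos : ∀ {x} → 0# < x → 0# < x ⁻¹
  ⁻¹-pos {x} p = *-cancelˡ-< (proj₁ p) (subst₂ _<_ (sym (zeroʳ x)) (sym (⁻¹-inverse p)) 0<1)

  ∣∣-cases : ∀ x → (0# ≤ x × ∣ x ∣ ≡ x) ⊎ (0# ≤ - x × ∣ x ∣ ≡ - x)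
  ∣∣-cases x with total 0# x
  ... | inj₁ p = inj₁ (p , refl)
  ... | inj₂ p = inj₂ (0≤-neg p , refl)

  ∣∣-nonNeg : ∀ x → 0# ≤ ∣ x ∣
  ∣∣-nonNeg x with ∣∣-cases x
  ... | inj₁ (p , eq) = subst (0# ≤_) (sym eq) p
  ... | inj₂ (p , eq) = subst (0# ≤_) (sym eq) p

  x≤∣x∣ : ∀ x → x ≤ ∣ x ∣
  x≤∣x∣ x with ∣∣-cases x
  ... | inj₁ (p , eq) = ≤-reflexive (sym eq)
  ... | inj₂ (p , eq) = subst (x ≤_) (sym eq) (≤-diff (+-nonNeg p p))

  -x≤∣x∣ : ∀ x → - x ≤ ∣ x ∣
  -x≤∣x∣ x with ∣∣-cases x
  ... | inj₁ (p , eq) = subst (- x ≤_) (sym eq) (≤-diff (subst (0# ≤_) (solve 1 (λ x → x :+ x := x :- (:- x)) refl x) (+-nonNeg p p)))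
  ... | inj₂ (p , eq) = ≤-reflexive (sym eq)

  ∣∣-≤ : ∀ {x c} → x ≤ c → - x ≤ c → ∣ x ∣ ≤ c
  ∣∣-≤ {x} p q with ∣∣-cases x
  ... | inj₁ (_ , eq) = subst (_≤ _) (sym eq) p
  ... | inj₂ (_ , eq) = subst (_≤ _) (sym eq) q

  ∣x+y∣≤∣x∣+∣y∣ : ∀ x y → ∣ x + y ∣ ≤ ∣ x ∣ + ∣ y ∣
  ∣x+y∣≤∣x∣+∣y∣ x y = ∣∣-≤ (+-mono-≤ (x≤∣x∣ x) (x≤∣x∣ y))
    (subst (_≤ ∣ x ∣ + ∣ y ∣) (solve 2 (λ x y → (:- x) :+ (:- y) := :- (x :+ y)) refl x y)
      (+-mono-≤ (-x≤∣x∣ x) (-x≤∣x∣ y)))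

  ∣x*y∣≤∣x∣*∣y∣ : ∀ x y → ∣ x * y ∣ ≤ ∣ x ∣ * ∣ y ∣
  ∣x*y∣≤∣x∣*∣y∣ x y with ∣∣-cases x | ∣∣-cases y
  ... | inj₁ (p , e) | inj₁ (q , f) = subst₂ (λ a b → ∣ x * y ∣ ≤ a * b) (sym e) (sym f)
    (∣∣-≤ ≤-refl (≤-diff (subst (0# ≤_) (solve 2 (λ x y → x :* y :+ x :* y := x :* y :- (:- (x :* y))) refl x y) (+-nonNeg xy xy))))
    where xy = *-nonNegative _ _ p q
  ... | inj₁ (p , e) | inj₂ (q , f) = subst₂ (λ a b → ∣ x * y ∣ ≤ a * b) (sym e) (sym f)
    (∣∣-≤ (≤-diff (subst (0# ≤_) (solve 2 (λ x y → x :* (:- y) :+ x :* (:- y) := x :* (:- y) :- x :* y) refl x y) (+-nonNeg xy xy)))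
      (≤-reflexive (solve 2 (λ x y → :- (x :* y) := x :* (:- y)) refl x y)))
    where xy = *-nonNegative _ _ p q
  ... | inj₂ (p , e) | inj₁ (q , f) = subst₂ (λ a b → ∣ x * y ∣ ≤ a * b) (sym e) (sym f)
    (∣∣-≤ (≤-diff (subst (0# ≤_) (solve 2 (λ x y → (:- x) :* y :+ (:- x) :* y := (:- x) :* y :- x :* y) refl x y) (+-nonNeg xy xy)))
      (≤-reflexive (solve 2 (λ x y → :- (x :* y) := (:- x) :* y) refl x y)))
    where xy = *-nonNegative _ _ p q
  ... | inj₂ (p , e) | inj₂ (q , f) = subst₂ (λ a b → ∣ x * y ∣ ≤ a * b) (sym e) (sym f)
    (∣∣-≤ (≤-reflexive (solve 2 (λ x y → x :* y := (:- x) :* (:- y)) refl x y))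
      (≤-diff (subst (0# ≤_) (solve 2 (λ x y → (:- x) :* (:- y) :+ (:- x) :* (:- y) := (:- x) :* (:- y) :- (:- (x :* y))) refl x y) (+-nonNeg xy xy))))
    where xy = *-nonNegative _ _ p q

  fromℕ-nonNeg : ∀ n → 0# ≤ fromℕ n
  fromℕ-nonNeg zero    = ≤-refl
  fromℕ-nonNeg (suc n) = +-nonNeg 0≤1 (fromℕ-nonNeg n)

  fromℕ-pos : ∀ n → 0# < fromℕ (suc n)
  fromℕ-pos n = +-pos-nonNeg 0<1 (fromℕ-nonNeg n)

  fromℕ-+ : ∀ m n → fromℕ (m ℕ.+ n) ≡ fromℕ m + fromℕ n
  fromℕ-+ m n = ·-homo-+ 1# m n

  fromℕ-mono-≤ : ∀ {m n} → m ℕ.≤ n → fromℕ m ≤ fromℕ n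
  fromℕ-mono-≤ {n = n} ℕ.z≤n = fromℕ-nonNeg n
  fromℕ-mono-≤ (ℕ.s≤s p)     = +-mono-≤ ≤-refl (fromℕ-mono-≤ p)

  fromℕ-mono-< : ∀ {m n} → m ℕ.< n → fromℕ m < fromℕ n
  fromℕ-mono-< {m} p = <-≤-trans
    (<-diff (subst (0# <_) (solve 1 (λ x → :1 := :1 :+ x :- x) refl (fromℕ m)) 0<1)) (fromℕ-mono-≤ p)

  fromℕ-cancel-≤ : ∀ {m n} → fromℕ m ≤ fromℕ n → m ℕ.≤ n
  fromℕ-cancel-≤ p = ℕ.≮⇒≥ λ q → <⇒≱ (fromℕ-mono-< q) p

  -- If every natural number were ≤ v, their supremum u would have u - 1 < n < n + 1 ≤ u for some n.
  archimedean : ∀ v → ∃[ n ] v ≤ fromℕ n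
  archimedean v with em 0ℓ {∃[ n ] v ≤ fromℕ n}
  ... | yes p = p
  ... | no ¬p with complete (λ r → ∃[ n ] r ≡ fromℕ n) (0# , 0 , refl)
                   (v , λ { _ (n , refl) → proj₁ (≰⇒> λ q → ¬p (n , q)) })
  ...   | u , lub = ⊥-elim (<⇒≱ (<-diff (subst (0# <_) (solve 1 (λ u → :1 := u :- (u :- :1)) refl u) 0<1))
            (IsLub.least lub (u - 1#) λ { _ (n , refl) → ≤-diff (subst (0# ≤_)
              (solve 2 (λ u n → u :- (:1 :+ n) := u :- :1 :- n) refl u (fromℕ n))
              (diff-≤ (IsLub.upper lub _ (suc n , refl)))) }))

vectors : ∀ {A : Set} → List A → ∀ n → List (Vec A n)
vectors xs zero    = [] ∷ []
vectors xs (suc n) = cartesianProductWith _∷_ xs (vectors xs n)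

∈-vectors : ∀ {A : Set} {xs : List A} → (∀ x → x ∈ xs) → ∀ {n} (v : Vec A n) → v ∈ vectors xs n
∈-vectors full []      = here refl
∈-vectors full (x ∷ v) = ∈-cartesianProductWith⁺ _∷_ (full x) (∈-vectors full v)

-- Measurable sets and maps.

module Measurability (em : ∀ ℓ → ExcludedMiddle ℓ) where

  open MeasurableSpace using (IsMeasurable)

  module Closure (M : MeasurableSpace) where
    private module σ = MeasurableSpace M

    private
      variable
        P Q : Pred σ.Carrier 0ℓ

    ∅-measurable : IsMeasurable M ∅
    ∅-measurable = σ.resp ((λ f → f tt) , λ ()) (σ.complement σ.whole)

    ∪-measurable : IsMeasurable M P → IsMeasurable M Q → IsMeasurable M (P ∪ Q)
    ∪-measurable {P} {Q} p q = σ.resp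
      ( (λ { (zero , x) → inj₁ x ; (suc _ , x) → inj₂ x })
      , λ { (inj₁ x) → 0 , x ; (inj₂ x) → 1 , x })
      (σ.union (λ { zero → P ; (suc _) → Q }) (λ { zero → p ; (suc _) → q }))

    ∩-measurable : IsMeasurable M P → IsMeasurable M Q → IsMeasurable M (P ∩ Q)
    ∩-measurable p q = σ.resp
      ( (λ f → decidable-stable (em 0ℓ) (f ∘ inj₁) , decidable-stable (em 0ℓ) (f ∘ inj₂))
      , λ { (x , y) (inj₁ f) → f x ; (x , y) (inj₂ f) → f y })
      (σ.complement (∪-measurable (σ.complement p) (σ.complement q)))

    -- Excluded middle makes the set everything or nothing. This settles conditions that depend only
    -- on the labels and the outlier set once those are fixed.
    const-measurable : (A : Set) → IsMeasurable M (λ _ → A)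
    const-measurable A with em 0ℓ {A}
    ... | yes a = σ.resp ((λ _ → a) , λ _ → tt) σ.whole
    ... | no ¬a = σ.resp ((λ ()) , λ a → ¬a a) ∅-measurable

    Any-measurable : ∀ {I : Set} (A : I → Pred σ.Carrier 0ℓ) → (∀ i → IsMeasurable M (A i)) →
                     ∀ is → IsMeasurable M (λ z → Any (λ i → A i z) is)
    Any-measurable A p []       = σ.resp ((λ ()) , λ ()) ∅-measurable
    Any-measurable A p (i ∷ is) = σ.resp
      ( (λ { (inj₁ a) → here a ; (inj₂ a) → there a })
      , λ { (here a) → inj₁ a ; (there a) → inj₂ a })
      (∪-measurable (p i) (Any-measurable A p is))

    ∀Fin-measurable : ∀ {n} (A : Fin n → Pred σ.Carrier 0ℓ) → (∀ i → IsMeasurable M (A i)) →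
                      IsMeasurable M (λ z → ∀ i → A i z)
    ∀Fin-measurable {zero}  A p = σ.resp ((λ _ ()) , λ _ → tt) σ.whole
    ∀Fin-measurable {suc n} A p = σ.resp
      ( (λ { (a , f) zero → a ; (a , f) (suc i) → f i })
      , λ f → f zero , f ∘ suc)
      (∩-measurable (p zero) (∀Fin-measurable (A ∘ suc) (p ∘ suc)))

    -- A finite-valued function cuts the space into finitely many pieces, on each of which A is measurable.
    fibrewise-measurable : ∀ {I : Set} {is : List I} → (∀ i → i ∈ is) → (g : σ.Carrier → I) →
      (∀ i → IsMeasurable M (λ z → g z ≡ i)) → (A : I → Pred σ.Carrier 0ℓ) → (∀ i → IsMeasurable M (A i)) →
      IsMeasurable M (λ z → A (g z) z)
    fibrewise-measurable {is = is} full g mg A mA = σ.resp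
      ( (λ {z} any → let (i , eq , a) = satisfied {P = λ i → g z ≡ i × A i z} any in subst (λ i → A i z) (sym eq) a)
      , λ {z} a → lose (full (g z)) (refl , a))
      (Any-measurable (λ i z → g z ≡ i × A i z) (λ i → ∩-measurable (mg i) (mA i)) is)

  -- Taking preimages commutes with complements and countable unions, so the generators suffice.
  generated-measurable : ∀ (M : MeasurableSpace) {B : Set} {G : Pred (Pred B 0ℓ) (lsuc 0ℓ)} {f : Points M → B} →
    (∀ Q → G Q → IsMeasurable M (f ⊢ Q)) → MeasurableMap M (generated G) f
  generated-measurable M {f = f} p _ = go
    where
    module σ = MeasurableSpace M
    go : ∀ {Q} → Generated _ Q → IsMeasurable M (f ⊢ Q)
    go (basic g)      = p _ g
    go whole          = σ.whole
    go (complement q) = σ.complement (go q)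
    go (union P q)    = σ.union _ (λ k → go (q k))
    go (resp (a , b) q) = σ.resp (a , b) (go q)

  pair-measurable : ∀ (M N₁ N₂ : MeasurableSpace) {f : Points M → Points N₁} {g : Points M → Points N₂} →
    MeasurableMap M N₁ f → MeasurableMap M N₂ g → MeasurableMap M (N₁ ⊗ N₂) (λ z → f z , g z)
  pair-measurable M N₁ N₂ mf mg = generated-measurable M
    λ { _ (P , Q , p , q , refl) → Closure.∩-measurable M (mf P p) (mg Q q) }

  proj₁-measurable : ∀ M N → MeasurableMap (M ⊗ N) M proj₁
  proj₁-measurable M N P p = MeasurableSpace.resp (M ⊗ N) (proj₁ , (_, tt))
    (basic (P , U , p , MeasurableSpace.whole N , refl))

  proj₂-measurable : ∀ M N → MeasurableMap (M ⊗ N) N proj₂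
  proj₂-measurable M N Q q = MeasurableSpace.resp (M ⊗ N) (proj₂ , (tt ,_))
    (basic (U , Q , MeasurableSpace.whole M , q , refl))

  -- The π-λ theorem.

  -- Unions are restricted to disjoint families because these are the ones across which equality of
  -- two probability measures propagates.
  data Dynkin {A : Set} (G : Pred (Pred A 0ℓ) (lsuc 0ℓ)) : Pred (Pred A 0ℓ) (lsuc 0ℓ) where
    basic      : ∀ {P} → G P → Dynkin G P
    whole      : Dynkin G U
    complement : ∀ {P} → Dynkin G P → Dynkin G (∁ P)
    union      : (P : ℕ → Pred A 0ℓ) → (∀ i j → i ≢ j → Disjoint (P i) (P j)) →
                 (∀ k → Dynkin G (P k)) → Dynkin G (⋃ ℕ P)
    resp       : ∀ {P Q} → P ≐ Q → Dynkin G P → Dynkin G Q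

  -- Intersections of generators need only lie in the Dynkin system. This accommodates boxes over
  -- distinct outlier sets, whose intersection is empty.
  module πλ {A : Set} (G : Pred (Pred A 0ℓ) (lsuc 0ℓ))
            (G-∩ : ∀ {P Q} → G P → G Q → Dynkin G (P ∩ Q)) where

    private
      variable
        P Q : Pred A 0ℓ

    ∅-Dynkin : Dynkin G ∅
    ∅-Dynkin = resp ((λ f → f tt) , λ ()) (complement whole)

    ⊎-Dynkin : Disjoint P Q → Dynkin G P → Dynkin G Q → Dynkin G (P ∪ Q)
    ⊎-Dynkin {P} {Q} disj p q = resp
      ( (λ { (0 , x) → inj₁ x ; (1 , x) → inj₂ x ; (suc (suc _) , ()) })
      , λ { (inj₁ x) → 0 , x ; (inj₂ x) → 1 , x })
      (union (λ { 0 → P ; 1 → Q ; (suc (suc _)) → ∅ })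
        (λ { 0 0 ne → ⊥-elim (ne refl) ; 0 1 _ → disj ; 0 (suc (suc _)) _ → λ ()
           ; 1 0 _ (x , y) → disj (y , x) ; 1 1 ne → ⊥-elim (ne refl) ; 1 (suc (suc _)) _ → λ ()
           ; (suc (suc _)) _ _ → λ () })
        (λ { 0 → p ; 1 → q ; (suc (suc _)) → ∅-Dynkin }))

    -- For fixed `Q`, the sets `P` with `P ∩ Q` in the system again form a Dynkin system. The case
    -- to check is the complement: `∁ P ∩ Q` is the complement of the disjoint union of `P ∩ Q` and
    -- `∁ Q`.
    ∩-Dynkin-from : Dynkin G Q → (∀ {P} → G P → Dynkin G (P ∩ Q)) → Dynkin G P → Dynkin G (P ∩ Q)
    ∩-Dynkin-from q base (basic g)      = base g
    ∩-Dynkin-from q base whole          = resp ((tt ,_) , proj₂) q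
    ∩-Dynkin-from q base (complement p) = resp
      ( (λ f → (λ x → f (inj₁ (x , decidable-stable (em 0ℓ) (f ∘ inj₂)))) , decidable-stable (em 0ℓ) (f ∘ inj₂))
      , λ { (¬x , y) (inj₁ (x , _)) → ¬x x ; (¬x , y) (inj₂ ¬y) → ¬y y })
      (complement (⊎-Dynkin (λ { ((_ , y) , ¬y) → ¬y y }) (∩-Dynkin-from q base p) (complement q)))
    ∩-Dynkin-from {Q} q base (union P disj p) = resp
      ( (λ { (k , x , y) → (k , x) , y }) , λ { ((k , x) , y) → k , x , y })
      (union (λ k → P k ∩ Q) (λ { i j ne ((x , _) , (y , _)) → disj i j ne (x , y) }) (λ k → ∩-Dynkin-from q base (p k)))
    ∩-Dynkin-from q base (resp (a , b) p) =
      resp ((λ { (x , y) → a x , y }) , λ { (x , y) → b x , y }) (∩-Dynkin-from q base p)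

    ∩-Dynkin : Dynkin G P → Dynkin G Q → Dynkin G (P ∩ Q)
    -- Two passes: the inner one intersects the arbitrary set `Q` with a generator, the outer one
    -- extends from generators to all `P`.
    ∩-Dynkin p q = ∩-Dynkin-from q (λ g → swap (∩-Dynkin-from (basic g) (λ h → G-∩ h g) q)) p
      where
      swap : Dynkin G (P ∩ Q) → Dynkin G (Q ∩ P)
      swap = resp ((λ { (x , y) → y , x }) , λ { (x , y) → y , x })

    module _ (P : ℕ → Pred A 0ℓ) where
      -- Used to make a union disjoint: each point of the union is credited to the first index whose
      -- set contains it.
      Before : ℕ → Pred A 0ℓ
      Before zero    = U
      Before (suc k) = Before k ∩ ∁ (P k)

      Before-¬ : ∀ {i j x} → i ℕ.< j → Before j x → ¬ P i x
      Before-¬ {i} {suc j} (ℕ.s≤s i≤j) (b , ¬p) with ℕ.m≤n⇒m<n∨m≡n i≤j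
      ... | inj₁ i<j  = Before-¬ i<j b
      ... | inj₂ refl = ¬p

      first-∈ : ∀ {x} k → Before k x ⊎ (∃[ i ] (P i ∩ Before i) x)
      first-∈ zero = inj₁ tt
      first-∈ {x} (suc k) with first-∈ {x} k | em 0ℓ {P k x}
      ... | inj₂ found | _      = inj₂ found
      ... | inj₁ b     | yes p  = inj₂ (k , p , b)
      ... | inj₁ b     | no ¬p  = inj₁ (b , ¬p)

      ⋃-Dynkin : (∀ k → Dynkin G (P k)) → Dynkin G (⋃ ℕ P)
      ⋃-Dynkin p = resp
        ( (λ { (k , x , _) → k , x })
        , λ { {x} (k , y) → cover k y (first-∈ {x} k) })
        (union (λ k → P k ∩ Before k) disj (λ k → ∩-Dynkin (p k) (before k)))
        where
        cover : ∀ {x} k → P k x → Before k x ⊎ (∃[ i ] (P i ∩ Before i) x) → ∃[ i ] (P i ∩ Before i) x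
        cover k y (inj₁ b) = k , y , b
        cover k y (inj₂ f) = f

        before : ∀ k → Dynkin G (Before k)
        before zero    = whole
        before (suc k) = ∩-Dynkin (before k) (complement (p k))

        disj : ∀ i j → i ≢ j → Disjoint (P i ∩ Before i) (P j ∩ Before j)
        disj i j ne ((x , b) , (y , c)) with ℕ.<-cmp i j
        ... | tri< i<j _ _ = Before-¬ i<j c x
        ... | tri≈ _ eq _  = ne eq
        ... | tri> _ _ j<i = Before-¬ j<i b y

    generated⇒Dynkin : Generated G P → Dynkin G P
    generated⇒Dynkin (basic g)      = basic g
    generated⇒Dynkin whole          = whole
    generated⇒Dynkin (complement p) = complement (generated⇒Dynkin p)
    generated⇒Dynkin (union P p)    = ⋃-Dynkin P (λ k → generated⇒Dynkin (p k))
    generated⇒Dynkin (resp e p)     = resp e (generated⇒Dynkin p)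

-- Finite sums, indicators and probability measures.

module Probability (em : ∀ ℓ → ExcludedMiddle ℓ) (R : CompleteOrderedField) where
  open RealField em R
  open Solver
  open Regression R hiding (pr)
  open Measurability em
  open MeasurableSpace using (IsMeasurable)

  sum-cong : ∀ {n} {f g : Fin n → ℝ} → (∀ i → f i ≡ g i) → sum f ≡ sum g
  sum-cong {zero}  eq = refl
  sum-cong {suc n} eq = cong₂ _+_ (eq zero) (sum-cong (eq ∘ suc))

  sum-0 : ∀ {n} {f : Fin n → ℝ} → (∀ i → f i ≡ 0#) → sum f ≡ 0#
  sum-0 {zero}  eq = refl
  sum-0 {suc n} eq = trans (cong₂ _+_ (eq zero) (sum-0 (eq ∘ suc))) (+-identityʳ 0#)

  ∑ : ∀ {I : Set} → List I → (I → ℝ) → ℝ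
  ∑ []       f = 0#
  ∑ (i ∷ is) f = f i + ∑ is f

  module _ {I : Set} where
    ∑-++ : ∀ is js (f : I → ℝ) → ∑ (is ++ js) f ≡ ∑ is f + ∑ js f
    ∑-++ []       js f = sym (+-identityˡ _)
    ∑-++ (i ∷ is) js f = trans (cong (f i +_) (∑-++ is js f)) (sym (+-assoc _ _ _))

    ∑-map : ∀ {J : Set} (g : J → I) js (f : I → ℝ) → ∑ (List.map g js) f ≡ ∑ js (f ∘ g)
    ∑-map g []       f = refl
    ∑-map g (j ∷ js) f = cong (f (g j) +_) (∑-map g js f)

    ∑-cong : ∀ is {f g : I → ℝ} → (∀ i → f i ≡ g i) → ∑ is f ≡ ∑ is g
    ∑-cong []       eq = refl
    ∑-cong (i ∷ is) eq = cong₂ _+_ (eq i) (∑-cong is eq)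

    ∑-mono : ∀ is {f g : I → ℝ} → (∀ i → f i ≤ g i) → ∑ is f ≤ ∑ is g
    ∑-mono []       p = ≤-refl
    ∑-mono (i ∷ is) p = +-mono-≤ (p i) (∑-mono is p)

    ∑-+ : ∀ is (f g : I → ℝ) → ∑ is (λ i → f i + g i) ≡ ∑ is f + ∑ is g
    ∑-+ []       f g = sym (+-identityʳ 0#)
    ∑-+ (i ∷ is) f g = trans (cong (f i + g i +_) (∑-+ is f g))
      (solve 4 (λ a b c d → a :+ b :+ (c :+ d) := a :+ c :+ (b :+ d)) refl (f i) (g i) (∑ is f) (∑ is g))

    ∑-*ˡ : ∀ c is (f : I → ℝ) → ∑ is (λ i → c * f i) ≡ c * ∑ is f
    ∑-*ˡ c []       f = sym (zeroʳ c)
    ∑-*ˡ c (i ∷ is) f = trans (cong (c * f i +_) (∑-*ˡ c is f)) (sym (distribˡ c _ _))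

  bits : ∀ n → List (Vec Bool n)
  bits = vectors (false ∷ true ∷ [])

  ∑-bits : ∀ n (f : Vec Bool (suc n) → ℝ) →
           ∑ (bits (suc n)) f ≡ ∑ (bits n) (f ∘ (false ∷_)) + ∑ (bits n) (f ∘ (true ∷_))
  ∑-bits n f = begin
    ∑ (List.map (false ∷_) (bits n) ++ List.map (true ∷_) (bits n) ++ []) f
      ≡⟨ ∑-++ (List.map (false ∷_) (bits n)) _ f ⟩
    ∑ (List.map (false ∷_) (bits n)) f + ∑ (List.map (true ∷_) (bits n) ++ []) f
      ≡⟨ cong₂ _+_ (∑-map _ (bits n) f) (trans (∑-++ (List.map (true ∷_) (bits n)) [] f) (+-identityʳ _)) ⟩
    ∑ (bits n) (f ∘ (false ∷_)) + ∑ (List.map (true ∷_) (bits n)) f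
      ≡⟨ cong (∑ (bits n) (f ∘ (false ∷_)) +_) (∑-map _ (bits n) f) ⟩
    ∑ (bits n) (f ∘ (false ∷_)) + ∑ (bits n) (f ∘ (true ∷_)) ∎
    where open ≡-Reasoning

  abstract
    𝟙 : Set → ℝ
    𝟙 A = if does (em 0ℓ {A}) then 1# else 0#

    𝟙-yes : ∀ {A} → A → 𝟙 A ≡ 1#
    𝟙-yes {A} a with em 0ℓ {A}
    ... | yes _ = refl
    ... | no ¬a = contradiction a ¬a

    𝟙-no : ∀ {A} → ¬ A → 𝟙 A ≡ 0#
    𝟙-no {A} ¬a with em 0ℓ {A}
    ... | yes a = contradiction a ¬a
    ... | no _  = refl

    𝟙-nonNeg : ∀ A → 0# ≤ 𝟙 A
    𝟙-nonNeg A with em 0ℓ {A}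
    ... | yes _ = 0≤1
    ... | no _  = ≤-refl

  module _ {M : MeasurableSpace} (ℙ : ProbabilityMeasure M) where
    open ProbabilityMeasure ℙ
    open Closure M

    private
      variable
        P Q : Pred (Points M) 0ℓ

    -- For the constant family `∅`, the partial sum of two terms already gives `pr ∅ + pr ∅ ≤ pr ∅`.
    pr-∅ : pr ∅ ≡ 0#
    pr-∅ = ≤-antisym (≤-diff (subst (0# ≤_) (solve 1 (λ e → e :- (e :+ (e :+ :0)) := :0 :- e) refl (pr ∅))
        (subst (λ a → 0# ≤ a - (pr ∅ + (pr ∅ + 0#))) ⋃≡ (diff-≤ (IsLub.upper lub _ (2 , refl))))))
      (pr-nonNeg ∅-measurable)
      where
      lub = pr-union (λ _ → ∅) (λ _ → ∅-measurable) (λ _ _ _ → λ ())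
      ⋃≡ : pr (⋃ ℕ (λ _ → ∅)) ≡ pr ∅
      ⋃≡ = pr-cong ((λ ()) , λ ()) (MeasurableSpace.union M _ λ _ → ∅-measurable)

    -- Padding the two sets with `∅` gives a countable family whose partial sums reach their
    -- supremum at the second term.
    pr-⊎ : IsMeasurable M P → IsMeasurable M Q → Disjoint P Q → pr (P ∪ Q) ≡ pr P + pr Q
    pr-⊎ {P} {Q} p q disj = trans (pr-cong
        ( (λ { (inj₁ x) → 0 , x ; (inj₂ x) → 1 , x })
        , λ { (0 , x) → inj₁ x ; (1 , x) → inj₂ x ; (suc (suc _) , ()) }) (∪-measurable p q))
      (≤-antisym (IsLub.least lub _ λ { _ (n , refl) → partial n })
        (subst (_≤ pr (⋃ ℕ S)) (cong (pr P +_) (+-identityʳ (pr Q))) (IsLub.upper lub _ (2 , refl))))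
      where
      S : ℕ → Pred (Points M) 0ℓ
      S 0             = P
      S 1             = Q
      S (suc (suc _)) = ∅

      S-disj : ∀ i j → i ≢ j → Disjoint (S i) (S j)
      S-disj 0             0             ne = ⊥-elim (ne refl)
      S-disj 0             1             _  = disj
      S-disj 0             (suc (suc _)) _  = λ ()
      S-disj 1             0             _  = λ { (x , y) → disj (y , x) }
      S-disj 1             1             ne = ⊥-elim (ne refl)
      S-disj 1             (suc (suc _)) _  = λ ()
      S-disj (suc (suc _)) _             _  = λ ()

      lub = pr-union S (λ { 0 → p ; 1 → q ; (suc (suc _)) → ∅-measurable }) S-disj

      partial : ∀ n → sum {n} (λ k → pr (S (toℕ k))) ≤ pr P + pr Q
      partial 0             = +-nonNeg (pr-nonNeg p) (pr-nonNeg q)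
      partial 1             = +-mono-≤ ≤-refl (pr-nonNeg q)
      partial (suc (suc n)) = ≤-reflexive (cong (pr P +_)
        (trans (cong (pr Q +_) (sum-0 {n} (λ _ → pr-∅))) (+-identityʳ _)))

    pr-split : IsMeasurable M P → IsMeasurable M Q → pr P ≡ pr (P ∩ Q) + pr (P ∩ ∁ Q)
    pr-split {P} {Q} p q = trans
      (pr-cong (split , λ { (inj₁ (x , _)) → x ; (inj₂ (x , _)) → x }) p)
      (pr-⊎ (∩-measurable p q) (∩-measurable p (MeasurableSpace.complement M q)) λ { ((_ , y) , (_ , ¬y)) → ¬y y })
      where
      split : ∀ {x} → P x → ((P ∩ Q) ∪ (P ∩ ∁ Q)) x
      split {x} px with em 0ℓ {Q x}
      ... | yes qx = inj₁ (px , qx)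
      ... | no ¬qx = inj₂ (px , ¬qx)

    pr-∁ : IsMeasurable M P → pr (∁ P) ≡ 1# - pr P
    pr-∁ {P} p = begin
      pr (∁ P)                                  ≡⟨ solve 2 (λ a b → a := b :+ a :- b) refl (pr (∁ P)) (pr P) ⟩
      pr P + pr (∁ P) - pr P                    ≡⟨ cong₂ (λ a b → a + b - pr P) (pr-cong ((tt ,_) , proj₂) p)
                                                    (pr-cong ((tt ,_) , proj₂) (MeasurableSpace.complement M p)) ⟩
      pr (U ∩ P) + pr (U ∩ ∁ P) - pr P          ≡⟨ cong (_- pr P) (sym (pr-split (MeasurableSpace.whole M) p)) ⟩
      pr U - pr P                               ≡⟨ cong (_- pr P) pr-whole ⟩
      1# - pr P                                 ∎
      where open ≡-Reasoning

    -- Monotonicity of the integral for a finite combination of indicators. The induction splits `P`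
    -- along `X i`: inside, this event supplies `w i` and the remaining ones must supply `c - w i`;
    -- outside, they must supply all of `c`. Hence both `P` and `c` vary.
    integrate-on : ∀ {I : Set} (is : List I) (w : I → ℝ) (X : I → Pred (Points M) 0ℓ) → (∀ i → IsMeasurable M (X i)) →
      IsMeasurable M P → ∀ c → (∀ z → P z → c ≤ ∑ is (λ i → w i * 𝟙 (X i z))) →
      c * pr P ≤ ∑ is (λ i → w i * pr (P ∩ X i))
    -- With no events left the hypothesis reads `c ≤ 0#` at any point of `P`; if there is no such
    -- point, `P` has probability zero.
    integrate-on {P} [] w X mX mP c h with em 0ℓ {∃[ z ] P z}
    ... | yes (z , pz) = subst (c * pr P ≤_) (zeroˡ (pr P)) (*-monoʳ-≤ (pr P) (pr-nonNeg mP) (h z pz))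
    ... | no empty     = ≤-reflexive (trans (cong (c *_)
      (trans (pr-cong ((λ pz → ⊥-elim (empty (_ , pz))) , λ ()) mP) pr-∅)) (zeroʳ c))
    integrate-on {P} (i ∷ is) w X mX mP c h = begin
      c * pr P
        ≡⟨ cong (c *_) (pr-split mP (mX i)) ⟩
      c * (pr P₁ + pr P₂)
        ≡⟨ solve 4 (λ c w a b → c :* (a :+ b) := w :* a :+ ((c :- w) :* a :+ c :* b)) refl c (w i) (pr P₁) (pr P₂) ⟩
      w i * pr P₁ + ((c - w i) * pr P₁ + c * pr P₂)
        ≤⟨ +-mono-≤ ≤-refl (+-mono-≤ (integrate-on is w X mX m₁ (c - w i) h₁) (integrate-on is w X mX m₂ c h₂)) ⟩
      w i * pr P₁ + (∑ is (λ j → w j * pr (P₁ ∩ X j)) + ∑ is (λ j → w j * pr (P₂ ∩ X j)))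
        ≡⟨ cong (w i * pr P₁ +_) (sym (∑-+ is _ _)) ⟩
      w i * pr P₁ + ∑ is (λ j → w j * pr (P₁ ∩ X j) + w j * pr (P₂ ∩ X j))
        ≡⟨ cong (w i * pr P₁ +_) (∑-cong is λ j → trans (sym (distribˡ (w j) _ _)) (cong (w j *_) (sym (recombine j)))) ⟩
      w i * pr P₁ + ∑ is (λ j → w j * pr (P ∩ X j)) ∎
      where
      open ≤-Reasoning
      P₁ = P ∩ X i
      P₂ = P ∩ ∁ (X i)
      m₁ = ∩-measurable mP (mX i)
      m₂ = ∩-measurable mP (MeasurableSpace.complement M (mX i))

      h₁ : ∀ z → P₁ z → c - w i ≤ ∑ is (λ j → w j * 𝟙 (X j z))
      h₁ z (pz , xz) = ≤-diff (subst (0# ≤_)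
        (trans (cong (λ e → w i * e + s - c) (𝟙-yes xz)) (solve 3 (λ w s c → w :* :1 :+ s :- c := s :- (c :- w)) refl (w i) s c))
        (diff-≤ (h z pz)))
        where s = ∑ is (λ j → w j * 𝟙 (X j z))

      h₂ : ∀ z → P₂ z → c ≤ ∑ is (λ j → w j * 𝟙 (X j z))
      h₂ z (pz , ¬xz) = subst (c ≤_) (trans (cong (λ e → w i * e + s) (𝟙-no ¬xz))
        (solve 2 (λ w s → w :* :0 :+ s := s) refl (w i) s)) (h z pz)
        where s = ∑ is (λ j → w j * 𝟙 (X j z))

      recombine : ∀ j → pr (P ∩ X j) ≡ pr (P₁ ∩ X j) + pr (P₂ ∩ X j)
      recombine j = trans (pr-split (∩-measurable mP (mX j)) (mX i)) (cong₂ _+_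
        (pr-cong ((λ { ((a , b) , c) → (a , c) , b }) , λ { ((a , c) , b) → (a , b) , c }) (∩-measurable (∩-measurable mP (mX j)) (mX i)))
        (pr-cong ((λ { ((a , b) , c) → (a , c) , b }) , λ { ((a , c) , b) → (a , b) , c }) (∩-measurable (∩-measurable mP (mX j)) (MeasurableSpace.complement M (mX i)))))

    integrate : ∀ {I : Set} (is : List I) (w : I → ℝ) (X : I → Pred (Points M) 0ℓ) → (∀ i → IsMeasurable M (X i)) →
      ∀ c → (∀ z → c ≤ ∑ is (λ i → w i * 𝟙 (X i z))) → c ≤ ∑ is (λ i → w i * pr (X i))
    integrate is w X mX c h = subst₂ _≤_ (trans (cong (c *_) pr-whole) (*-identityʳ c))
      (∑-cong is λ i → cong (w i *_) (pr-cong (proj₂ , (tt ,_)) (∩-measurable (MeasurableSpace.whole M) (mX i))))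
      (integrate-on is w X mX (MeasurableSpace.whole M) c (λ z _ → h z))

  -- Measurability is carried through the induction because `pr` is meaningful only on measurable
  -- sets and the additivity axiom asks for it.
  Dynkin-unique : ∀ {M : MeasurableSpace} {G : Pred (Pred (Points M) 0ℓ) (lsuc 0ℓ)} (μ ν : ProbabilityMeasure M) →
    (∀ {P} → G P → IsMeasurable M P) → (∀ {P} → G P → ProbabilityMeasure.pr μ P ≡ ProbabilityMeasure.pr ν P) →
    ∀ {P} → Dynkin G P → IsMeasurable M P × (ProbabilityMeasure.pr μ P ≡ ProbabilityMeasure.pr ν P)
  Dynkin-unique {M} {G} μ ν G-meas agree = go
    where
    module μ = ProbabilityMeasure μ
    module ν = ProbabilityMeasure ν
    module M = MeasurableSpace M

    go : ∀ {P} → Dynkin G P → IsMeasurable M P × (μ.pr P ≡ ν.pr P)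
    go (basic g)      = G-meas g , agree g
    go whole          = M.whole , trans μ.pr-whole (sym ν.pr-whole)
    go (complement p) = let (m , eq) = go p in
      M.complement m , trans (pr-∁ μ m) (trans (cong (λ a → 1# - a) eq) (sym (pr-∁ ν m)))
    go (union P disj p) = M.union P meas , ≤-antisym
      (IsLub.least (μ.pr-union P meas disj) _ λ { _ (n , refl) →
        subst (_≤ ν.pr (⋃ ℕ P)) (sum-cong {n} λ k → sym (proj₂ (go (p (toℕ k))))) (IsLub.upper (ν.pr-union P meas disj) _ (n , refl)) })
      (IsLub.least (ν.pr-union P meas disj) _ λ { _ (n , refl) →
        subst (_≤ μ.pr (⋃ ℕ P)) (sum-cong {n} λ k → proj₂ (go (p (toℕ k)))) (IsLub.upper (μ.pr-union P meas disj) _ (n , refl)) })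
      where
      meas : ∀ k → IsMeasurable M (P k)
      meas k = proj₁ (go (p k))
    go (resp e p) = let (m , eq) = go p in
      M.resp e m , trans (sym (μ.pr-cong e m)) (trans eq (ν.pr-cong e m))

-- Chebyshev peaks on blocks.

module Chebyshev (em : ∀ ℓ → ExcludedMiddle ℓ) (R : CompleteOrderedField) where
  open RealField em R
  open Solver
  open Regression R

  -- The index counts coefficients, so the degree is below `n`. Pointwise equality lets degree
  -- bounds pass through a composition without expanding it.
  Represented : ℕ → (ℝ → ℝ) → Set
  Represented n f = Σ[ p ∈ Vec ℝ n ] (∀ t → eval p t ≡ f t)

  represented-1 : Represented 1 (λ _ → 1#)
  represented-1 = 1# ∷ [] , λ t → solve 1 (λ t → :1 :+ t :* :0 := :1) refl t

  represented-0 : ∀ n → Represented n (λ _ → 0#)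
  represented-0 zero    = [] , λ _ → refl
  represented-0 (suc n) = let (p , e) = represented-0 n in
    0# ∷ p , λ t → trans (cong (λ z → 0# + t * z) (e t)) (solve 1 (λ t → :0 :+ t :* :0 := :0) refl t)

  _+ᵖ_ : ∀ {n} → Vec ℝ n → Vec ℝ n → Vec ℝ n
  _+ᵖ_ = zipWith _+_

  eval-+ᵖ : ∀ {n} (p q : Vec ℝ n) t → eval (p +ᵖ q) t ≡ eval p t + eval q t
  eval-+ᵖ []      []      t = sym (+-identityʳ 0#)
  eval-+ᵖ (a ∷ p) (b ∷ q) t = trans (cong (λ z → a + b + t * z) (eval-+ᵖ p q t))
    (solve 5 (λ a b t x y → a :+ b :+ t :* (x :+ y) := a :+ t :* x :+ (b :+ t :* y)) refl a b t (eval p t) (eval q t))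

  eval-scale : ∀ {n} c (p : Vec ℝ n) t → eval (Vec.map (c *_) p) t ≡ c * eval p t
  eval-scale c []      t = sym (zeroʳ c)
  eval-scale c (a ∷ p) t = trans (cong (λ z → c * a + t * z) (eval-scale c p t))
    (solve 4 (λ c a t x → c :* a :+ t :* (c :* x) := c :* (a :+ t :* x)) refl c a t (eval p t))

  represented-+ : ∀ {n f g} → Represented n f → Represented n g → Represented n (λ t → f t + g t)
  represented-+ (p , e) (q , e′) = p +ᵖ q , λ t → trans (eval-+ᵖ p q t) (cong₂ _+_ (e t) (e′ t))

  represented-scale : ∀ {n f} c → Represented n f → Represented n (λ t → c * f t)
  represented-scale c (p , e) = Vec.map (c *_) p , λ t → trans (eval-scale c p t) (cong (c *_) (e t))

  represented-shift : ∀ {n f} → Represented n f → Represented (suc n) (λ t → t * f t)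
  represented-shift (p , e) = 0# ∷ p , λ t → trans (+-identityˡ _) (cong (t *_) (e t))

  represented-cong : ∀ {n f g} → (∀ t → f t ≡ g t) → Represented n f → Represented n g
  represented-cong eq (p , e) = p , λ t → trans (e t) (eq t)

  represented-pad : ∀ {m n f} → m ℕ.≤ n → Represented m f → Represented n f
  represented-pad {n = n} ℕ.z≤n ([] , e) = represented-cong e (represented-0 n)
  represented-pad (ℕ.s≤s m≤n) (a ∷ p , e) = let (q , e′) = represented-pad m≤n (p , λ _ → refl) in
    a ∷ q , λ t → trans (cong (λ z → a + t * z) (e′ t)) (e t)

  -- T k and V k are the Chebyshev polynomials T_k of the first and U_{k-1} of the second kind.
  mutual
    T V : ℕ → ℝ → ℝ
    T zero    y = 1#
    T (suc k) y = y * T k y - (1# - y * y) * V k y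
    V zero    y = 0#
    V (suc k) y = T k y + y * V k y

  -- The algebraic form of cos² + sin² = 1: at `y` = cos θ, `T k y` is cos kθ and `V k y` times sin
  -- θ is sin kθ.
  pell : ∀ k y → T k y * T k y + (1# - y * y) * (V k y * V k y) ≡ 1#
  pell zero    y = solve 1 (λ y → :1 :* :1 :+ (:1 :- y :* y) :* (:0 :* :0) := :1) refl y
  pell (suc k) y = trans (solve 3
    (λ y a b → (y :* a :- (:1 :- y :* y) :* b) :* (y :* a :- (:1 :- y :* y) :* b)
        :+ (:1 :- y :* y) :* ((a :+ y :* b) :* (a :+ y :* b))
      := a :* a :+ (:1 :- y :* y) :* (b :* b)) refl y (T k y) (V k y)) (pell k y)

  square≤1⇒∣∣≤1 : ∀ {x} → x * x ≤ 1# → ∣ x ∣ ≤ 1#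
  square≤1⇒∣∣≤1 {x} p = ∣∣-≤ (half x p)
    (half (- x) (subst (_≤ 1#) (solve 1 (λ x → x :* x := (:- x) :* (:- x)) refl x) p))
    where
    half : ∀ x → x * x ≤ 1# → x ≤ 1#
    half x p = ≮⇒≥ λ 1<x → <⇒≱ (<-≤-trans 1<x (subst (_≤ x * x) (*-identityˡ x) (*-monoʳ-≤ x (≤-trans 0≤1 (proj₁ 1<x)) (proj₁ 1<x)))) p

  1≤∣∣⇒1≤square : ∀ {x} → 1# ≤ ∣ x ∣ → 1# ≤ x * x
  1≤∣∣⇒1≤square {x} p with ∣∣-cases x
  ... | inj₁ (q , e) = subst (_≤ x * x) (*-identityˡ 1#) (*-mono-≤ q 0≤1 p′ p′)
    where p′ = subst (1# ≤_) e p
  ... | inj₂ (q , e) = subst₂ _≤_ (*-identityˡ 1#) (solve 1 (λ x → (:- x) :* (:- x) := x :* x) refl x) (*-mono-≤ q 0≤1 p′ p′)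
    where p′ = subst (1# ≤_) e p

  -- On [-1,1] the second term of `pell` is nonnegative, so the square of `T k y` is at most 1.
  ∣T∣≤1 : ∀ k {y} → - 1# ≤ y → y ≤ 1# → ∣ T k y ∣ ≤ 1#
  ∣T∣≤1 k {y} p q = square≤1⇒∣∣≤1 (subst (T k y * T k y ≤_) (pell k y)
    (≤-diff (subst (0# ≤_)
      (solve 3 (λ y a b → (y :- (:- :1)) :* (:1 :- y) :* (b :* b) := a :* a :+ (:1 :- y :* y) :* (b :* b) :- a :* a) refl y (T k y) (V k y))
      (*-nonNegative _ _ (*-nonNegative _ _ (diff-≤ p) (diff-≤ q)) (square-nonNeg (V k y))))))

  -- At `y` = 1 + h the recursion reads T' = (1 + h) T + (2h + h²) V and V' = T + (1 + h) V. The
  -- gain of T' over T is at least h + 2hk, which is (k + 1)²h - k²h; this needs the bound on `V` in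
  -- the same induction.
  T-growth : ∀ k {h} → 0# ≤ h → 1# + fromℕ k * fromℕ k * h ≤ T k (1# + h) × fromℕ k ≤ V k (1# + h)
  T-growth zero {h} p = ≤-reflexive (solve 1 (λ h → :1 :+ :0 :* :0 :* h := :1) refl h) , ≤-refl
  T-growth (suc k) {h} p = ≤-diff (subst (0# ≤_)
      (solve 4 (λ κ h t u →
          t :- (:1 :+ κ :* κ :* h) :+ h :* (t :- :1) :+ (h :+ h :+ h :* h) :* (u :- κ) :+ h :* (h :* κ)
        := (:1 :+ h) :* t :- (:1 :- (:1 :+ h) :* (:1 :+ h)) :* u :- (:1 :+ (:1 :+ κ) :* (:1 :+ κ) :* h))
        refl (fromℕ k) h (T k (1# + h)) (V k (1# + h)))
      (+-nonNeg (+-nonNeg (+-nonNeg (diff-≤ Tk) (*-nonNegative _ _ p (diff-≤ 1≤T)))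
        (*-nonNegative _ _ (+-nonNeg (+-nonNeg p p) (square-nonNeg h)) (diff-≤ Uk)))
        (*-nonNegative _ _ p (*-nonNegative _ _ p (fromℕ-nonNeg k)))))
    , +-mono-≤ 1≤T (≤-trans Uk (≤-diff (subst (0# ≤_)
        (solve 2 (λ h u → h :* u := (:1 :+ h) :* u :- u) refl h (V k (1# + h)))
        (*-nonNegative _ _ p (≤-trans (fromℕ-nonNeg k) Uk)))))
    where
    Tk = proj₁ (T-growth k p)
    Uk = proj₂ (T-growth k p)
    1≤T : 1# ≤ T k (1# + h)
    1≤T = ≤-trans (≤-diff (subst (0# ≤_) (solve 1 (λ x → x := :1 :+ x :- :1) refl (fromℕ k * fromℕ k * h))
      (*-nonNegative _ _ (square-nonNeg (fromℕ k)) p))) Tk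

  module _ {y : ℝ → ℝ} (quadratic : ∀ {n f} → Represented n f → Represented (2 ℕ.+ n) (λ t → y t * f t)) where
    -- The step for `T` contains `y * (y * V)`, two products with a quadratic, hence four more
    -- coefficients each time; `V` is given the same bound.
    T-represented : ∀ k → Represented (suc (k ℕ.* 4)) (λ t → T k (y t))
    V-represented : ∀ k → Represented (suc (k ℕ.* 4)) (λ t → V k (y t))
    T-represented zero    = represented-1
    T-represented (suc k) = represented-cong
      (λ t → solve 3 (λ y a b → y :* a :+ ((:- :1) :* b :+ y :* (y :* b)) := y :* a :- (:1 :- y :* y) :* b) refl (y t) (T k (y t)) (V k (y t)))
      (represented-+ (represented-pad (ℕ.m≤n+m _ 2) (quadratic (T-represented k)))
        (represented-+ (represented-scale (- 1#) (represented-pad (ℕ.m≤n+m _ 4) (V-represented k)))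
          (quadratic (quadratic (V-represented k)))))
    V-represented zero    = represented-0 1
    V-represented (suc k) = represented-+ (represented-pad (ℕ.m≤n+m _ 4) (T-represented k))
      (represented-pad (ℕ.m≤n+m _ 2) (quadratic (V-represented k)))

  -- [-1,1] is cut into m equal blocks; u j maps the j-th one affinely onto [-1,1].
  module Blocks (m : ℕ) (0<m : 0 ℕ.< m) where
    M η : ℝ
    M = fromℕ m
    η = (M * M + M * M) ⁻¹

    0<M : 0# < M
    0<M = fromℕ-mono-< 0<m

    0<MM+MM : 0# < M * M + M * M
    0<MM+MM = +-pos-nonNeg (*-pos 0<M 0<M) (square-nonNeg M)

    0<η : 0# < η
    0<η = ⁻¹-pos 0<MM+MM

    η-inverse : (M * M + M * M) * η ≡ 1#
    η-inverse = ⁻¹-inverse 0<MM+MM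

    u : Fin m → ℝ → ℝ
    u j t = M * t + (M - (1# + (fromℕ (toℕ j) + fromℕ (toℕ j))))

    -- Strictness makes the blocks open and pairwise disjoint. A common endpoint belongs to no
    -- block, and there every peak is still at most 1.
    InBlock : Fin m → ℝ → Set
    InBlock j t = ∣ u j t ∣ < 1#

    -- For `j` before `k`, `u j t - u k t` is twice the index difference, hence at least 2, while
    -- both terms are below 1 in absolute value.
    InBlock-≮ : ∀ j k {t} → InBlock j t → InBlock k t → ¬ (toℕ j ℕ.< toℕ k)
    InBlock-≮ j k {t} p q j<k = <⇒≱ (+-< p q) (≤-trans two≤ (+-mono-≤ (x≤∣x∣ (u j t)) (-x≤∣x∣ (u k t))))
      where
      +-< : ∀ {a b} → a < 1# → b < 1# → a + b < 1# + 1#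
      +-< {a} {b} a<1 b<1 = <-diff (subst (0# <_)
        (solve 2 (λ a b → (:1 :- a) :+ (:1 :- b) := :1 :+ :1 :- (a :+ b)) refl a b) (+-pos-nonNeg (diff-< a<1) (proj₁ (diff-< b<1))))
      gap : 0# ≤ fromℕ (toℕ k) - fromℕ (suc (toℕ j))
      gap = diff-≤ (fromℕ-mono-≤ j<k)
      two≤ : 1# + 1# ≤ u j t + - u k t
      two≤ = ≤-diff (subst (0# ≤_)
        (solve 4 (λ j k x M → (k :- (:1 :+ j)) :+ (k :- (:1 :+ j)) :=
            (x :+ (M :- (:1 :+ (j :+ j)))) :+ (:- (x :+ (M :- (:1 :+ (k :+ k))))) :- (:1 :+ :1))
          refl (fromℕ (toℕ j)) (fromℕ (toℕ k)) (M * t) M) (+-nonNeg gap gap))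

    InBlock-unique : ∀ j k {t} → InBlock j t → InBlock k t → j ≡ k
    InBlock-unique j k p q with ℕ.<-cmp (toℕ j) (toℕ k)
    ... | tri< j<k _ _ = contradiction j<k (InBlock-≮ j k p q)
    ... | tri≈ _ eq _  = Fin.toℕ-injective eq
    ... | tri> _ _ k<j = contradiction k<j (InBlock-≮ k j q p)

    u-difference : ∀ j s t → u j s ≡ u j t + M * (s - t)
    u-difference j s t = solve 4 (λ M s t c → M :* s :+ c := M :* t :+ c :+ M :* (s :- t)) refl
      M s t (M - (1# + (fromℕ (toℕ j) + fromℕ (toℕ j))))

    InBlock-open : ∀ j t → InBlock j t → ∃[ r ] 0# < r × (∀ s → ∣ s - t ∣ < r → InBlock j s)
    -- `u j` has slope `M`, so the slack `1# - ∣ u j t ∣` is divided by `M`.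
    InBlock-open j t p = (1# - ∣ u j t ∣) * M ⁻¹ , *-pos (diff-< p) (⁻¹-pos 0<M) , λ s s<r →
      ≤-<-trans (subst (_≤ ∣ u j t ∣ + M * ∣ s - t ∣) (cong ∣_∣ (sym (u-difference j s t)))
          (≤-trans (∣x+y∣≤∣x∣+∣y∣ (u j t) (M * (s - t))) (+-mono-≤ ≤-refl (∣M*∣ (s - t)))))
        (<-diff (subst (0# <_) (cancel ∣ u j t ∣ ∣ s - t ∣) (*-pos 0<M (diff-< s<r))))
      where
      ∣M*∣ : ∀ x → ∣ M * x ∣ ≤ M * ∣ x ∣
      ∣M*∣ x = ∣∣-≤ (*-monoˡ-≤ M (proj₁ 0<M) (x≤∣x∣ x))
        (subst (_≤ M * ∣ x ∣) (solve 2 (λ M x → M :* (:- x) := :- (M :* x)) refl M x) (*-monoˡ-≤ M (proj₁ 0<M) (-x≤∣x∣ x)))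
      cancel : ∀ a b → M * ((1# - a) * M ⁻¹ - b) ≡ 1# - (a + M * b)
      cancel a b = trans (solve 4 (λ M I a b → M :* ((:1 :- a) :* I :- b) := (:1 :- a) :* (M :* I) :- M :* b) refl M (M ⁻¹) a b)
        (trans (cong (λ z → (1# - a) * z - M * b) (⁻¹-inverse 0<M))
          (solve 3 (λ M a b → (:1 :- a) :* :1 :- M :* b := :1 :- (a :+ M :* b)) refl M a b))

    -- The quadratic exceeds 1 exactly on the block, by `η` at its centre. On [-1,1] one has |u| ≤
    -- 2M, and `η` = 1/(2M²) is small enough to keep the value above -1.
    y : Fin m → ℝ → ℝ
    y j t = 1# + η * (1# - u j t * u j t)

    y-quadratic : ∀ j {n f} → Represented n f → Represented (2 ℕ.+ n) (λ t → y j t * f t)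
    y-quadratic j {f = f} r = represented-cong
      (λ t → solve 3 (λ η u f → f :+ (η :* f :+ (:- η) :* (u :* (u :* f))) := (:1 :+ η :* (:1 :- u :* u)) :* f) refl η (u j t) (f t))
      (represented-+ r₂ (represented-+ (represented-scale η r₂) (represented-scale (- η) (affine (affine r)))))
      where
      r₂ = represented-pad (ℕ.m≤n+m _ 2) r
      affine : ∀ {n f} → Represented n f → Represented (suc n) (λ t → u j t * f t)
      affine {f = f} r = represented-cong
        (λ t → solve 4 (λ M t c f → M :* (t :* f) :+ c :* f := (M :* t :+ c) :* f) refl M t _ (f t))
        (represented-+ (represented-scale M (represented-shift r)) (represented-scale _ (represented-pad (ℕ.n≤1+n _) r)))

    -- The coefficient vector has 4k+1 entries (a crude bound: T k (y j t) has degree 2k in t).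
    abstract
      peak-represented : ∀ k j → Represented (suc (k ℕ.* 4)) (λ t → T k (y j t))
      peak-represented k j = T-represented {y j} (y-quadratic j) k

    peak : ∀ k → Fin m → Vec ℝ (suc (k ℕ.* 4))
    peak k j = proj₁ (peak-represented k j)

    eval-peak : ∀ k j t → eval (peak k j) t ≡ T k (y j t)
    eval-peak k j = proj₂ (peak-represented k j)

    2j+1≤2m : ∀ (j : Fin m) → 1# + (fromℕ (toℕ j) + fromℕ (toℕ j)) ≤ M + M
    2j+1≤2m j = ≤-diff (subst (0# ≤_)
      (solve 2 (λ M j → (M :- (:1 :+ j)) :+ (M :- (:1 :+ j)) :+ :1 := M :+ M :- (:1 :+ (j :+ j))) refl M (fromℕ (toℕ j)))
      (+-nonNeg (+-nonNeg gap gap) 0≤1))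
      where gap = diff-≤ (fromℕ-mono-≤ (Fin.toℕ<n j))

    peak-small : ∀ k j {t} → - 1# ≤ t → t ≤ 1# → ¬ InBlock j t → ∣ eval (peak k j) t ∣ ≤ 1#
    peak-small k j {t} -1≤t t≤1 out = subst (λ z → ∣ z ∣ ≤ 1#) (sym (eval-peak k j t)) (∣T∣≤1 k lower upper)
      where
      v = u j t
      upper : y j t ≤ 1#
      upper = ≤-diff (subst (0# ≤_) (solve 2 (λ η v → η :* (v :* v :- :1) := :1 :- (:1 :+ η :* (:1 :- v :* v))) refl η v)
        (*-nonNegative _ _ (proj₁ 0<η) (diff-≤ (1≤∣∣⇒1≤square (≮⇒≥ out)))))
      v≤2M : 0# ≤ M + M - v
      v≤2M = subst (0# ≤_) (solve 3 (λ M t j → M :* (:1 :- t) :+ (:1 :+ j) := M :+ M :- (M :* t :+ (M :- (:1 :+ j)))) refl M t _)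
        (+-nonNeg (*-nonNegative _ _ (proj₁ 0<M) (diff-≤ t≤1)) (+-nonNeg 0≤1 (+-nonNeg (fromℕ-nonNeg (toℕ j)) (fromℕ-nonNeg (toℕ j)))))
      -2M≤v : 0# ≤ M + M + v
      -2M≤v = subst (0# ≤_) (solve 3 (λ M t c → M :* (t :- (:- :1)) :+ (M :+ M :- c) := M :+ M :+ (M :* t :+ (M :- c))) refl M t _)
        (+-nonNeg (*-nonNegative _ _ (proj₁ 0<M) (diff-≤ -1≤t)) (diff-≤ (2j+1≤2m j)))
      -- Since 4M²η = 2, `y j t` + 1 equals η + η(2M - v)(2M + v).
      lower : - 1# ≤ y j t
      lower = ≤-diff (subst (0# ≤_)
        (trans (solve 3 (λ η M v → η :+ η :* ((M :+ M :- v) :* (M :+ M :+ v)) := η :* (:1 :- v :* v) :+ ((M :* M :+ M :* M) :* η :+ (M :* M :+ M :* M) :* η)) refl η M v)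
          (trans (cong (λ z → η * (1# - v * v) + (z + z)) η-inverse)
            (solve 1 (λ x → x :+ (:1 :+ :1) := :1 :+ x :- (:- :1)) refl (η * (1# - v * v)))))
        (+-nonNeg (proj₁ 0<η) (*-nonNegative _ _ (proj₁ 0<η) (*-nonNegative _ _ v≤2M -2M≤v))))

    centre : Fin m → ℝ
    centre j = (1# + (fromℕ (toℕ j) + fromℕ (toℕ j))) * M ⁻¹ - 1#

    centre-lower : ∀ j → - 1# ≤ centre j
    centre-lower j = ≤-diff (subst (0# ≤_) (solve 1 (λ x → x := x :- :1 :- (:- :1)) refl _)
      (*-nonNegative _ _ (+-nonNeg 0≤1 (+-nonNeg (fromℕ-nonNeg (toℕ j)) (fromℕ-nonNeg (toℕ j)))) (proj₁ (⁻¹-pos 0<M))))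

    centre-upper : ∀ j → centre j ≤ 1#
    centre-upper j = ≤-diff (subst (0# ≤_)
      (trans (solve 3 (λ M c I → (M :+ M :- c) :* I := (M :* I) :+ (M :* I) :- c :* I) refl M _ (M ⁻¹))
        (trans (cong (λ z → z + z - c * M ⁻¹) (⁻¹-inverse 0<M)) (solve 1 (λ x → :1 :+ :1 :- x := :1 :- (x :- :1)) refl (c * M ⁻¹))))
      (*-nonNegative _ _ (diff-≤ (2j+1≤2m j)) (proj₁ (⁻¹-pos 0<M))))
      where c = 1# + (fromℕ (toℕ j) + fromℕ (toℕ j))

    u-centre : ∀ j → u j (centre j) ≡ 0#
    u-centre j = trans (solve 3 (λ M c I → M :* (c :* I :- :1) :+ (M :- c) := c :* (M :* I) :- c) refl M c (M ⁻¹))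
      (trans (cong (λ z → c * z - c) (⁻¹-inverse 0<M)) (solve 1 (λ c → c :* :1 :- c := :0) refl c))
      where c = 1# + (fromℕ (toℕ j) + fromℕ (toℕ j))

    peak-centre : ∀ k j → 1# + fromℕ k * fromℕ k * η ≤ eval (peak k j) (centre j)
    peak-centre k j = subst (1# + fromℕ k * fromℕ k * η ≤_)
      (trans (cong (T k) (trans (solve 1 (λ η → :1 :+ η := :1 :+ η :* (:1 :- :0 :* :0)) refl η)
          (cong (λ z → 1# + η * (1# - z * z)) (sym (u-centre j)))))
        (sym (eval-peak k j (centre j))))
      (proj₁ (T-growth k (proj₁ 0<η)))

  -- The bound `b` serves the induction, through s e - t f = e (s - t) + t (e - f). The Lipschitz
  -- constant later makes sampled values continuous in the points.
  lipschitz : ∀ {n} (p : Vec ℝ n) → ∃[ b ] ∃[ l ] 0# ≤ b × 0# ≤ l ×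
    (∀ {t} → ∣ t ∣ ≤ 1# → ∣ eval p t ∣ ≤ b) ×
    (∀ {s t} → ∣ s ∣ ≤ 1# → ∣ t ∣ ≤ 1# → ∣ eval p s - eval p t ∣ ≤ l * ∣ s - t ∣)
  lipschitz [] = 0# , 0# , ≤-refl , ≤-refl , (λ _ → ∣∣-≤ ≤-refl -0≤0) ,
    λ {s} {t} _ _ → subst (λ z → ∣ z ∣ ≤ 0# * ∣ s - t ∣) (sym (-‿inverseʳ 0#)) (≤-trans (∣∣-≤ ≤-refl -0≤0) (≤-reflexive (sym (zeroˡ _))))
    where
    -0≤0 : - 0# ≤ 0#
    -0≤0 = ≤-reflexive (solve 0 (:- :0 := :0) refl)
  lipschitz (a ∷ p) with lipschitz p
  ... | b , l , 0≤b , 0≤l , bounded , lip = ∣ a ∣ + b , b + l , +-nonNeg (∣∣-nonNeg a) 0≤b , +-nonNeg 0≤b 0≤l , bound , lip′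
    where
    open ≤-Reasoning
    bound : ∀ {t} → ∣ t ∣ ≤ 1# → ∣ a + t * eval p t ∣ ≤ ∣ a ∣ + b
    bound {t} t≤1 = begin
      ∣ a + t * eval p t ∣          ≤⟨ ∣x+y∣≤∣x∣+∣y∣ _ _ ⟩
      ∣ a ∣ + ∣ t * eval p t ∣      ≤⟨ +-mono-≤ ≤-refl (∣x*y∣≤∣x∣*∣y∣ _ _) ⟩
      ∣ a ∣ + ∣ t ∣ * ∣ eval p t ∣  ≤⟨ +-mono-≤ ≤-refl (*-mono-≤ 0≤1 (∣∣-nonNeg _) t≤1 (bounded t≤1)) ⟩
      ∣ a ∣ + 1# * b                ≡⟨ cong (∣ a ∣ +_) (*-identityˡ b) ⟩
      ∣ a ∣ + b                     ∎
    lip′ : ∀ {s t} → ∣ s ∣ ≤ 1# → ∣ t ∣ ≤ 1# → ∣ a + s * eval p s - (a + t * eval p t) ∣ ≤ (b + l) * ∣ s - t ∣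
    lip′ {s} {t} s≤1 t≤1 = begin
      ∣ a + s * eval p s - (a + t * eval p t) ∣
        ≡⟨ cong ∣_∣ (solve 5 (λ a s t e f → a :+ s :* e :- (a :+ t :* f) := e :* (s :- t) :+ t :* (e :- f)) refl a s t (eval p s) (eval p t)) ⟩
      ∣ eval p s * (s - t) + t * (eval p s - eval p t) ∣
        ≤⟨ ∣x+y∣≤∣x∣+∣y∣ _ _ ⟩
      ∣ eval p s * (s - t) ∣ + ∣ t * (eval p s - eval p t) ∣
        ≤⟨ +-mono-≤ (∣x*y∣≤∣x∣*∣y∣ _ _) (∣x*y∣≤∣x∣*∣y∣ _ _) ⟩
      ∣ eval p s ∣ * ∣ s - t ∣ + ∣ t ∣ * ∣ eval p s - eval p t ∣
        ≤⟨ +-mono-≤ (*-monoʳ-≤ _ (∣∣-nonNeg _) (bounded s≤1)) (*-mono-≤ 0≤1 (∣∣-nonNeg _) t≤1 (lip s≤1 t≤1)) ⟩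
      b * ∣ s - t ∣ + 1# * (l * ∣ s - t ∣)
        ≡⟨ solve 3 (λ b l x → b :* x :+ :1 :* (l :* x) := (b :+ l) :* x) refl b l ∣ s - t ∣ ⟩
      (b + l) * ∣ s - t ∣ ∎

-- Outlier patterns and exposed blocks.

private
  variable
    m n : ℕ

first : Vec Bool m → Maybe (Fin m)
first []          = nothing
first (true  ∷ h) = just zero
first (false ∷ h) = Maybe.map suc (first h)

first-true : ∀ (h : Vec Bool m) {j} → first h ≡ just j → lookup h j ≡ true
first-true (true  ∷ h) refl = refl
first-true (false ∷ h) eq   with first h in e | eq
... | just j | refl = first-true h e

-- A label names the block containing a sample; live keeps the blocks all of whose samples are outliers.
live : Vec (Maybe (Fin m)) n → Subset n → Vec Bool m → Vec Bool m
live []            []          y = y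
live (nothing ∷ a) (_     ∷ S) y = live a S y
live (just j  ∷ a) (true  ∷ S) y = live a S y
live (just j  ∷ a) (false ∷ S) y = live a S (y [ j ]≔ false)

live-⊆ : ∀ (a : Vec (Maybe (Fin m)) n) S y {j} → lookup (live a S y) j ≡ true → lookup y j ≡ true
live-⊆ []            []          y p = p
live-⊆ (nothing ∷ a) (_     ∷ S) y p = live-⊆ a S y p
live-⊆ (just j  ∷ a) (true  ∷ S) y p = live-⊆ a S y p
live-⊆ (just k  ∷ a) (false ∷ S) y {j} p with live-⊆ a S (y [ k ]≔ false) p | k Fin.≟ j
... | q | yes refl = contradiction (trans (sym (lookup∘update k y false)) q) λ ()
... | q | no k≢j   = trans (sym (lookup∘update′ (k≢j ∘ sym) y false)) q

-- A non-outlier clears the bit of its block, and by `live-⊆` a cleared bit never returns.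
live-outlier : ∀ (a : Vec (Maybe (Fin m)) n) S y {j} → lookup (live a S y) j ≡ true →
               ∀ i → lookup a i ≡ just j → lookup S i ≡ true
live-outlier (just j  ∷ a) (true  ∷ S) y p zero    eq   = refl
live-outlier (just j  ∷ a) (false ∷ S) y p zero    refl =
  contradiction (trans (sym (lookup∘update j y false)) (live-⊆ a S (y [ j ]≔ false) p)) λ ()
live-outlier (nothing ∷ a) (_     ∷ S) y p (suc i) eq   = live-outlier a S y p i eq
live-outlier (just j  ∷ a) (true  ∷ S) y p (suc i) eq   = live-outlier a S y p i eq
live-outlier (just j  ∷ a) (false ∷ S) y p (suc i) eq   = live-outlier a S (y [ j ]≔ false) p i eq

counts : Vec (Maybe (Fin m)) n → Vec ℕ m
counts []            = replicate _ 0
counts (nothing ∷ a) = counts a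
counts (just j  ∷ a) = updateAt (counts a) j suc

sum-counts : ∀ (a : Vec (Maybe (Fin m)) n) → Vec.sum (counts a) ℕ.≤ n
sum-counts {m} []        = ℕ.≤-reflexive (sum-replicate-0 m)
  where
  sum-replicate-0 : ∀ m → Vec.sum (replicate m 0) ≡ 0
  sum-replicate-0 zero    = refl
  sum-replicate-0 (suc m) = sum-replicate-0 m
sum-counts (nothing ∷ a) = ℕ.m≤n⇒m≤1+n (sum-counts a)
sum-counts (just j  ∷ a) = subst (ℕ._≤ _) (sym (sum-updateAt-suc (counts a) j)) (ℕ.s≤s (sum-counts a))
  where
  sum-updateAt-suc : ∀ {m} (cs : Vec ℕ m) j → Vec.sum (updateAt cs j suc) ≡ suc (Vec.sum cs)
  sum-updateAt-suc (c ∷ cs) zero    = refl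
  sum-updateAt-suc (c ∷ cs) (suc j) = trans (cong (c ℕ.+_) (sum-updateAt-suc cs j)) (ℕ.+-suc c _)

-- The probability that some block is exposed.

module Exposure (em : ∀ ℓ → ExcludedMiddle ℓ) (R : CompleteOrderedField) where
  open RealField em R
  open Solver
  open Regression R
  open Probability em R
  open Exp semiring using (_^_)

  -- The indicator that no bit is set, in a recursive form that agrees with `miss` when no samples
  -- remain.
  none : Vec Bool m → ℝ
  none []          = 1#
  none (true  ∷ y) = 0#
  none (false ∷ y) = none y

  none-first : ∀ (y : Vec Bool m) → none y + 𝟙 (∃[ j ] first y ≡ just j) ≡ 1#
  none-first []         = trans (cong (1# +_) (𝟙-no λ { (_ , ()) })) (+-identityʳ 1#)
  none-first (true ∷ y) = trans (cong (0# +_) (𝟙-yes (zero , refl))) (+-identityˡ 1#)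
  none-first (false ∷ y) with first y in eq | none-first y
  ... | nothing | ih = trans (cong (none y +_) (trans (𝟙-no λ { (_ , ()) }) (sym (𝟙-no λ { (_ , ()) })))) ih
  ... | just j  | ih = trans (cong (none y +_) (trans (𝟙-yes (suc j , refl)) (sym (𝟙-yes (j , refl))))) ih

  module _ (ρ : ℝ) where
    -- The probability that every block marked in `y` contains a non-outlier, for blocks of sizes
    -- `cs`; different blocks contain different samples, so the factors are independent.
    miss : Vec Bool m → Vec ℕ m → ℝ
    miss []          []       = 1#
    miss (true  ∷ y) (c ∷ cs) = (1# - ρ ^ c) * miss y cs
    miss (false ∷ y) (c ∷ cs) = miss y cs

    miss-0 : ∀ (y : Vec Bool m) → miss y (replicate m 0) ≡ none y
    miss-0 []          = refl
    miss-0 (true  ∷ y) = trans (cong (_* miss y _) (-‿inverseʳ 1#)) (zeroˡ _)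
    miss-0 (false ∷ y) = miss-0 y

    -- Conditioning on one more sample of block `j`: with probability `1# - ρ` it is a non-outlier
    -- and block `j` is settled, otherwise the requirement stays as it was.
    miss-suc : ∀ (y : Vec Bool m) cs j →
               miss y (updateAt cs j suc) ≡ (1# - ρ) * miss (y [ j ]≔ false) cs + ρ * miss y cs
    miss-suc (true  ∷ y) (c ∷ cs) zero    = solve 3
      (λ ρ x p → (:1 :- ρ :* x) :* p := (:1 :- ρ) :* p :+ ρ :* ((:1 :- x) :* p)) refl ρ (ρ ^ c) (miss y cs)
    miss-suc (false ∷ y) (c ∷ cs) zero    = solve 2
      (λ ρ p → p := (:1 :- ρ) :* p :+ ρ :* p) refl ρ (miss y cs)
    miss-suc (true  ∷ y) (c ∷ cs) (suc j) = trans (cong ((1# - ρ ^ c) *_) (miss-suc y cs j)) (solve 4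
      (λ ρ x p q → (:1 :- x) :* ((:1 :- ρ) :* p :+ ρ :* q) := (:1 :- ρ) :* ((:1 :- x) :* p) :+ ρ :* ((:1 :- x) :* q))
      refl ρ (ρ ^ c) (miss (y [ j ]≔ false) cs) (miss y cs))
    miss-suc (false ∷ y) (c ∷ cs) (suc j) = miss-suc y cs j

    ∑-outliers : ∀ (f : Vec Bool (suc n) → ℝ) →
      ∑ (bits (suc n)) (λ S → outlierWeight ρ S * f S) ≡
        (1# - ρ) * ∑ (bits n) (λ S → outlierWeight ρ S * f (false ∷ S)) + ρ * ∑ (bits n) (λ S → outlierWeight ρ S * f (true ∷ S))
    ∑-outliers {n} f = trans (∑-bits n _) (cong₂ _+_ (pull (1# - ρ) false) (pull ρ true))
      where
      pull : ∀ c b → ∑ (bits n) (λ S → c * outlierWeight ρ S * f (b ∷ S)) ≡ c * ∑ (bits n) (λ S → outlierWeight ρ S * f (b ∷ S))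
      pull c b = trans (∑-cong (bits n) λ S → *-assoc c (outlierWeight ρ S) (f (b ∷ S))) (∑-*ˡ c (bits n) (λ S → outlierWeight ρ S * f (b ∷ S)))

    -- Induction over the samples with `y` general, since a non-outlier clears a bit; the step is
    -- `miss-suc`.
    ∑-live : ∀ (a : Vec (Maybe (Fin m)) n) y →
             ∑ (bits n) (λ S → outlierWeight ρ S * none (live a S y)) ≡ miss y (counts a)
    ∑-live []            y = trans (solve 1 (λ x → :1 :* x :+ :0 := x) refl (none y)) (sym (miss-0 y))
    ∑-live (nothing ∷ a) y = trans (∑-outliers (λ S → none (live (nothing ∷ a) S y)))
      (trans (cong₂ (λ p q → (1# - ρ) * p + ρ * q) (∑-live a y) (∑-live a y))
        (solve 2 (λ ρ p → (:1 :- ρ) :* p :+ ρ :* p := p) refl ρ (miss y (counts a))))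
    ∑-live (just j  ∷ a) y = trans (∑-outliers (λ S → none (live (just j ∷ a) S y)))
      (trans (cong₂ (λ p q → (1# - ρ) * p + ρ * q) (∑-live a (y [ j ]≔ false)) (∑-live a y))
        (sym (miss-suc y (counts a) j)))

    ∑-weight : ∀ n → ∑ (bits n) (λ S → outlierWeight ρ S * 1#) ≡ 1#
    ∑-weight zero    = solve 0 (:1 :* :1 :+ :0 := :1) refl
    ∑-weight (suc n) = trans (∑-outliers {n} (λ _ → 1#)) (trans (cong (λ z → (1# - ρ) * z + ρ * z) (∑-weight n))
      (solve 1 (λ ρ → (:1 :- ρ) :* :1 :+ ρ :* :1 := :1) refl ρ))

    module _ (0≤ρ : 0# ≤ ρ) (ρ≤1 : ρ ≤ 1#) where
      ^-nonNeg : ∀ c → 0# ≤ ρ ^ c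
      ^-nonNeg zero    = 0≤1
      ^-nonNeg (suc c) = *-nonNegative _ _ 0≤ρ (^-nonNeg c)

      ^-≤1 : ∀ c → ρ ^ c ≤ 1#
      ^-≤1 zero    = ≤-refl
      ^-≤1 (suc c) = subst (ρ ^ suc c ≤_) (*-identityˡ 1#) (*-mono-≤ 0≤1 (^-nonNeg c) ρ≤1 (^-≤1 c))

      ^-antitone : ∀ {c k} → c ℕ.≤ k → ρ ^ k ≤ ρ ^ c
      ^-antitone {k = k} ℕ.z≤n = ^-≤1 k
      ^-antitone (ℕ.s≤s p)     = *-monoˡ-≤ ρ 0≤ρ (^-antitone p)

      powers : Vec ℕ m → ℝ
      powers []       = 0#
      powers (c ∷ cs) = ρ ^ c + powers cs

      powers-nonNeg : ∀ (cs : Vec ℕ m) → 0# ≤ powers cs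
      powers-nonNeg []       = ≤-refl
      powers-nonNeg (c ∷ cs) = +-nonNeg (^-nonNeg c) (powers-nonNeg cs)

      miss-nonNeg : ∀ (cs : Vec ℕ m) → 0# ≤ miss (replicate m true) cs
      miss-nonNeg []       = 0≤1
      miss-nonNeg (c ∷ cs) = *-nonNegative _ _ (diff-≤ (^-≤1 c)) (miss-nonNeg cs)

      -- ∏ (1 - xᵢ) ≤ 1 / ∏ (1 + xᵢ) ≤ 1 / (1 + ∑ xᵢ)
      miss-powers : ∀ (cs : Vec ℕ m) → miss (replicate m true) cs * (1# + powers cs) ≤ 1#
      miss-powers []       = ≤-reflexive (solve 0 (:1 :* (:1 :+ :0) := :1) refl)
      miss-powers (c ∷ cs) = ≤-trans (≤-diff (subst (0# ≤_)
        (solve 3 (λ x p s → p :* (x :* x :+ x :* s) := p :* (:1 :+ s) :- (:1 :- x) :* p :* (:1 :+ (x :+ s))) refl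
          (ρ ^ c) (miss (replicate _ true) cs) (powers cs))
        (*-nonNegative _ _ (miss-nonNeg cs) (+-nonNeg (square-nonNeg _) (*-nonNegative _ _ (^-nonNeg c) (powers-nonNeg cs))))))
        (miss-powers cs)

      -- Markov's inequality: on average a block has few samples, so many blocks have at most K.
      powers-lower : ∀ K (cs : Vec ℕ m) → ρ ^ K * (fromℕ m * fromℕ K - fromℕ (Vec.sum cs)) ≤ fromℕ K * powers cs
      powers-lower K [] = ≤-reflexive (solve 2 (λ r k → r :* (:0 :* k :- :0) := k :* :0) refl (ρ ^ K) (fromℕ K))
      powers-lower {suc m} K (c ∷ cs) = subst₂ _≤_
        (trans (solve 5 (λ r m k c s → r :* (k :- c) :+ r :* (m :* k :- s) := r :* ((:1 :+ m) :* k :- (c :+ s))) refl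
          (ρ ^ K) (fromℕ m) (fromℕ K) (fromℕ c) (fromℕ (Vec.sum cs)))
          (cong (λ z → ρ ^ K * (fromℕ (suc m) * fromℕ K - z)) (sym (fromℕ-+ c (Vec.sum cs)))))
        (sym (distribˡ _ _ _)) (+-mono-≤ one (powers-lower K cs))
        where
        -- If `c ≤ K`, then `ρ ^ c` is at least `ρ ^ K`; otherwise the left side is not positive.
        one : ρ ^ K * (fromℕ K - fromℕ c) ≤ fromℕ K * ρ ^ c
        one with ℕ.≤-total c K
        ... | inj₁ c≤K = ≤-trans (≤-diff (subst (0# ≤_)
          (solve 3 (λ r k c → r :* c := k :* r :- r :* (k :- c)) refl (ρ ^ K) (fromℕ K) (fromℕ c))
          (*-nonNegative _ _ (^-nonNeg K) (fromℕ-nonNeg c)))) (*-monoˡ-≤ _ (fromℕ-nonNeg K) (^-antitone c≤K))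
        ... | inj₂ K≤c = ≤-trans (≤-diff (subst (0# ≤_)
          (solve 3 (λ r k c → r :* (c :- k) := :0 :- r :* (k :- c)) refl (ρ ^ K) (fromℕ K) (fromℕ c))
          (*-nonNegative _ _ (^-nonNeg K) (diff-≤ (fromℕ-mono-≤ K≤c)))))
          (*-nonNegative _ _ (fromℕ-nonNeg K) (^-nonNeg c))

      -- The hypotheses give `ρ ^ K * fromℕ m` ≥ 4 and at most mK/2 samples, so the powers sum to at
      -- least half of that, 2, and missing has probability at most 1/(1 + 2). The bound holds for
      -- every label vector, which is what lets the distribution of the points be arbitrary.
      exposed-likely : ∀ b K → 1# ≤ ρ * fromℕ (2 ℕ.^ b) → 0 ℕ.< K →
        4 ℕ.* 2 ℕ.^ (b ℕ.* K) ℕ.≤ m → 2 ℕ.* n ℕ.≤ m ℕ.* K → (a : Vec (Maybe (Fin m)) n) →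
        fromℕ 2 ≤ fromℕ 3 * ∑ (bits n) (λ S → outlierWeight ρ S * 𝟙 (∃[ j ] first (live a S (replicate m true)) ≡ just j))
      exposed-likely {m} {n} b K 1≤ρ2ᵇ 0<K 4·2ᵇᴷ≤m 2n≤mK a = begin
        fromℕ 2                              ≤⟨ ≤-diff (subst (0# ≤_) (solve 1 (λ p → (:1 :- p :* (:3)) := (:3 :* (:1 :- p) :- :2)) refl p) (diff-≤ p*3≤1)) ⟩
        fromℕ 3 * (1# - p)                   ≡⟨ cong (fromℕ 3 *_) (trans (cong₂ (λ s q → s - q) (sym (∑-weight n)) (sym (∑-live a _))) (split-∑)) ⟩
        fromℕ 3 * ∑ (bits n) (λ S → outlierWeight ρ S * hit S) ∎
        where
        open ≤-Reasoning
        :2 :3 : ∀ {n} → Polynomial n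
        :2 = :1 :+ (:1 :+ :0)
        :3 = :1 :+ (:1 :+ (:1 :+ :0))
        cs = counts a
        p = miss (replicate m true) cs
        hit : Subset n → ℝ
        hit S = 𝟙 (∃[ j ] first (live a S (replicate m true)) ≡ just j)

        split-∑ : ∑ (bits n) (λ S → outlierWeight ρ S * 1#) - ∑ (bits n) (λ S → outlierWeight ρ S * none (live a S (replicate m true)))
                  ≡ ∑ (bits n) (λ S → outlierWeight ρ S * hit S)
        split-∑ = trans (cong (_- N) (trans (∑-cong (bits n) λ S →
            trans (cong (outlierWeight ρ S *_) (sym (none-first (live a S (replicate m true))))) (distribˡ _ _ _)) (∑-+ (bits n) _ _)))
          (solve 2 (λ x y → x :+ y :- x := y) refl N _)
          where N = ∑ (bits n) (λ S → outlierWeight ρ S * none (live a S (replicate m true)))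

        1≤ρᴷ2ᵇᴷ : ∀ K → 1# ≤ ρ ^ K * fromℕ (2 ℕ.^ (b ℕ.* K))
        1≤ρᴷ2ᵇᴷ zero = ≤-reflexive (sym (trans (*-identityˡ (fromℕ (2 ℕ.^ (b ℕ.* 0)))) (trans (cong (λ e → fromℕ (2 ℕ.^ e)) (ℕ.*-zeroʳ b)) (+-identityʳ 1#))))
        1≤ρᴷ2ᵇᴷ (suc K) = subst₂ _≤_ (*-identityˡ 1#)
          (trans (solve 4 (λ ρ x r y → ρ :* x :* (r :* y) := ρ :* r :* (x :* y)) refl ρ (fromℕ (2 ℕ.^ b)) (ρ ^ K) (fromℕ (2 ℕ.^ (b ℕ.* K))))
            (cong (ρ ^ suc K *_) (trans (sym (fromℕ-* (2 ℕ.^ b) (2 ℕ.^ (b ℕ.* K))))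
              (cong fromℕ (trans (sym (ℕ.^-distribˡ-+-* 2 b (b ℕ.* K))) (cong (2 ℕ.^_) (sym (ℕ.*-suc b K))))))))
          (*-mono-≤ (*-nonNegative _ _ 0≤ρ (fromℕ-nonNeg (2 ℕ.^ b))) 0≤1 1≤ρ2ᵇ (1≤ρᴷ2ᵇᴷ K))

        4≤ρᴷm : fromℕ 4 ≤ ρ ^ K * fromℕ m
        4≤ρᴷm = begin
          fromℕ 4                                      ≡⟨ sym (*-identityʳ _) ⟩
          fromℕ 4 * 1#                                 ≤⟨ *-monoˡ-≤ _ (fromℕ-nonNeg 4) (1≤ρᴷ2ᵇᴷ K) ⟩
          fromℕ 4 * (ρ ^ K * fromℕ (2 ℕ.^ (b ℕ.* K)))  ≡⟨ solve 3 (λ f r t → f :* (r :* t) := r :* (f :* t)) refl (fromℕ 4) (ρ ^ K) (fromℕ (2 ℕ.^ (b ℕ.* K))) ⟩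
          ρ ^ K * (fromℕ 4 * fromℕ (2 ℕ.^ (b ℕ.* K)))  ≡⟨ cong (ρ ^ K *_) (sym (fromℕ-* 4 (2 ℕ.^ (b ℕ.* K)))) ⟩
          ρ ^ K * fromℕ (4 ℕ.* 2 ℕ.^ (b ℕ.* K))        ≤⟨ *-monoˡ-≤ _ (^-nonNeg K) (fromℕ-mono-≤ 4·2ᵇᴷ≤m) ⟩
          ρ ^ K * fromℕ m                              ∎

        2c≤mK : fromℕ 2 * fromℕ (Vec.sum cs) ≤ fromℕ m * fromℕ K
        2c≤mK = subst₂ _≤_ (fromℕ-* 2 (Vec.sum cs)) (fromℕ-* m K)
          (fromℕ-mono-≤ (ℕ.≤-trans (ℕ.*-monoʳ-≤ 2 (sum-counts a)) 2n≤mK))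

        2≤powers : fromℕ 2 ≤ powers cs
        2≤powers = *-cancelˡ-≤ {z = fromℕ 2 * fromℕ K} (*-pos (fromℕ-pos 1) (fromℕ-mono-< 0<K)) (begin
          fromℕ 2 * fromℕ K * fromℕ 2                       ≡⟨ solve 1 (λ k → :2 :* k :* :2 := k :* (:1 :+ :3)) refl (fromℕ K) ⟩
          fromℕ K * fromℕ 4                                 ≤⟨ *-monoˡ-≤ _ (fromℕ-nonNeg K) 4≤ρᴷm ⟩
          fromℕ K * (ρ ^ K * fromℕ m)                       ≤⟨ ≤-diff (subst (0# ≤_)
            (solve 4 (λ k r m c → r :* (m :* k :- :2 :* c) := :2 :* (r :* (m :* k :- c)) :- k :* (r :* m)) refl (fromℕ K) (ρ ^ K) (fromℕ m) (fromℕ (Vec.sum cs)))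
            (*-nonNegative _ _ (^-nonNeg K) (diff-≤ 2c≤mK))) ⟩
          fromℕ 2 * (ρ ^ K * (fromℕ m * fromℕ K - fromℕ (Vec.sum cs))) ≤⟨ *-monoˡ-≤ _ (fromℕ-nonNeg 2) (powers-lower K cs) ⟩
          fromℕ 2 * (fromℕ K * powers cs)                   ≡⟨ sym (*-assoc _ _ _) ⟩
          fromℕ 2 * fromℕ K * powers cs                     ∎)

        p*3≤1 : p * fromℕ 3 ≤ 1#
        p*3≤1 = ≤-trans (*-monoˡ-≤ p (miss-nonNeg cs) (+-mono-≤ ≤-refl 2≤powers)) (miss-powers cs)

  -- This is 2^m, kept as a sum so that it splits along `∑-bits`.
  ones : ℕ → ℝ
  ones m = ∑ (bits m) λ _ → 1#

  ones-pos : ∀ m → 0# < ones m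
  ones-pos zero    = subst (0# <_) (sym (+-identityʳ 1#)) 0<1
  ones-pos (suc m) = subst (0# <_) (sym (∑-bits m _)) (+-pos-nonNeg (ones-pos m) (proj₁ (ones-pos m)))

  -- Summing the hypothesis over all ε meets each vector twice, once for either value of bit `j`;
  -- hence the doubled sum.
  ∑-pairs : ∀ (j : Fin m) (f : Vec Bool m → ℝ) →
    (∀ ε → 1# ≤ f (ε [ j ]≔ false) + f (ε [ j ]≔ true)) → ones m ≤ ∑ (bits m) f + ∑ (bits m) f
  ∑-pairs {suc m} zero f h = subst₂ _≤_ (sym (∑-bits m _)) (sym (cong (λ z → z + z) (∑-bits m f)))
    (+-mono-≤ half half)
    where
    half : ones m ≤ ∑ (bits m) (f ∘ (false ∷_)) + ∑ (bits m) (f ∘ (true ∷_))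
    half = subst (ones m ≤_) (∑-+ (bits m) _ _) (∑-mono (bits m) λ ε → h (false ∷ ε))
  ∑-pairs {suc m} (suc j) f h = subst₂ _≤_ (sym (∑-bits m _))
    (trans (solve 2 (λ a b → (a :+ a) :+ (b :+ b) := (a :+ b) :+ (a :+ b)) refl _ _) (sym (cong (λ z → z + z) (∑-bits m f))))
    (+-mono-≤ (∑-pairs j (f ∘ (false ∷_)) λ ε → h (false ∷ ε)) (∑-pairs j (f ∘ (true ∷_)) λ ε → h (true ∷ ε)))

-- Choosing the number of blocks.

module Logarithm where
  2^-cancel-≤ : ∀ {a b} → 2 ℕ.^ a ℕ.≤ 2 ℕ.^ b → a ℕ.≤ b
  2^-cancel-≤ {a} {b} p = ℕ.≮⇒≥ λ b<a → ℕ.<⇒≱ (ℕ.^-monoʳ-< 2 (ℕ.s≤s (ℕ.s≤s ℕ.z≤n)) b<a) p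

  2^-cancel-< : ∀ {a b} → 2 ℕ.^ a ℕ.< 2 ℕ.^ b → a ℕ.< b
  2^-cancel-< {a} {b} p = ℕ.≰⇒> λ b≤a → ℕ.<⇒≱ p (ℕ.^-monoʳ-≤ 2 b≤a)

  n<2^n : ∀ n → n ℕ.< 2 ℕ.^ n
  n<2^n zero    = ℕ.s≤s ℕ.z≤n
  n<2^n (suc n) = ℕ.+-mono-≤ (ℕ.≤-trans (ℕ.s≤s ℕ.z≤n) (n<2^n n)) (ℕ.≤-trans (n<2^n n) (ℕ.m≤m+n _ _))

  floor-log₂ : ∀ d → 1 ℕ.≤ d → ∃[ ℓ ] 2 ℕ.^ ℓ ℕ.≤ d × d ℕ.< 2 ℕ.^ suc ℓ
  floor-log₂ 1 _ = 0 , ℕ.≤-refl , ℕ.≤-refl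
  floor-log₂ (suc d@(suc _)) _ with floor-log₂ d (ℕ.s≤s ℕ.z≤n)
  ... | ℓ , lo , hi with ℕ.m≤n⇒m<n∨m≡n hi
  ...   | inj₁ lt = ℓ , ℕ.m≤n⇒m≤1+n lo , lt
  ...   | inj₂ eq = suc ℓ , ℕ.≤-reflexive (sym eq) ,
    subst (ℕ._< 2 ℕ.^ suc (suc ℓ)) (sym eq) (ℕ.^-monoʳ-< 2 (ℕ.s≤s (ℕ.s≤s ℕ.z≤n)) (ℕ.n<1+n (suc ℓ)))

  multiple-above : ∀ x c .{{_ : NonZero c}} → ∃[ K ] 0 ℕ.< K × x ℕ.≤ c ℕ.* K × c ℕ.* K ℕ.≤ x ℕ.+ c
  multiple-above x c = suc (x / c) , ℕ.s≤s ℕ.z≤n ,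
    ℕ.≤-trans (ℕ.≤-reflexive (m≡m%n+[m/n]*n x c))
      (ℕ.≤-trans (ℕ.+-monoˡ-≤ _ (ℕ.<⇒≤ (m%n<n x c))) (ℕ.≤-reflexive (sym eq))) ,
    ℕ.≤-trans (ℕ.≤-reflexive eq) (ℕ.≤-trans (ℕ.+-monoʳ-≤ c (m/n*n≤m x c)) (ℕ.≤-reflexive (ℕ.+-comm c x)))
    where
    eq : c ℕ.* suc (x / c) ≡ c ℕ.+ x / c ℕ.* c
    eq = trans (ℕ.*-suc c (x / c)) (cong (c ℕ.+_) (ℕ.*-comm c (x / c)))

module Asymptotics (em : ∀ ℓ → ExcludedMiddle ℓ) (R : CompleteOrderedField) where
  open RealField em R
  open Solver
  open Regression R
  open Logarithm

  -- Any admissible fraction satisfies 2^a ≤ d^(b+1) ≤ 2^(ℓ(b+1)), and comparing exponents bounds it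
  -- by ℓ.
  log₂-upper : ∀ {d ℓ L} → d ℕ.< 2 ℕ.^ ℓ → IsLog₂ d L → L ≤ fromℕ ℓ
  log₂-upper {d} {ℓ} d<2^ℓ lub = IsLub.least lub _ λ { _ (a , b , 2^a≤d^b , refl) →
    subst (fromℕ a * fromℕ (suc b) ⁻¹ ≤_)
      (trans (cong (_* fromℕ (suc b) ⁻¹) (fromℕ-* ℓ (suc b)))
        (trans (*-assoc _ _ _) (trans (cong (fromℕ ℓ *_) (⁻¹-inverse (fromℕ-pos b))) (*-identityʳ _))))
      (*-monoʳ-≤ (fromℕ (suc b) ⁻¹) (proj₁ (⁻¹-pos (fromℕ-pos b))) (fromℕ-mono-≤ (2^-cancel-≤ {a} {ℓ ℕ.* suc b}
        (ℕ.≤-trans 2^a≤d^b (ℕ.≤-trans (ℕ.^-monoˡ-≤ (suc b) (ℕ.<⇒≤ d<2^ℓ)) (ℕ.≤-reflexive (ℕ.^-*-assoc 2 ℓ (suc b)))))))) }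

  -- From s(d) = o(d log d): with m = 2^μ = Θ(d) blocks, the average number of samples per block is at most
  -- K/2, where 2^(bK) = O(√d).
  choose-blocks : ∀ β b .{{_ : NonZero b}} s → IsLittleO-dlogd s → ∃[ N ] (∀ d → N ℕ.≤ d → ∃[ μ ] ∃[ K ]
    0 ℕ.< K × 4 ℕ.* 2 ℕ.^ (b ℕ.* K) ℕ.≤ 2 ℕ.^ μ × 2 ℕ.* s d ℕ.≤ 2 ℕ.^ μ ℕ.* K ×
    (2 ℕ.* (2 ℕ.^ β ℕ.* 2 ℕ.^ μ)) ℕ.* 4 ℕ.≤ d)
  choose-blocks β b@(suc _) s o = N₁ ℕ.+ 2 ℕ.^ ℓ₀ , λ d N≤d →
    let 2^ℓ₀≤d = ℕ.≤-trans (ℕ.m≤n+m _ N₁) N≤d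
        (ℓ , lo , hi) = floor-log₂ d (ℕ.≤-trans (ℕ.m^n>0 2 ℓ₀) 2^ℓ₀≤d)
        (L , isLog , s≤) = small d (ℕ.≤-trans (ℕ.m≤m+n N₁ _) N≤d)
        ℓ₀≤ℓ = ℕ.≤-pred (2^-cancel-< {ℓ₀} {suc ℓ} (ℕ.≤-<-trans 2^ℓ₀≤d hi))
    in conclude d ℓ lo hi ℓ₀≤ℓ (E*s≤ d (suc ℓ) L hi isLog s≤)
    where
    B E ℓ₀ : ℕ
    B  = 2 ℕ.^ β
    -- The factor 16B comes from d < 2^(ℓ+1) = 16BM, and 4b combines ℓ + 1 ≤ 2bK with the 2 in the
    -- bound on the average.
    E  = 16 ℕ.* B ℕ.* (4 ℕ.* b)
    -- The summand β + 3 makes the truncated subtraction in `μ` exact; the rest gives 2 + bK ≤ μ.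
    ℓ₀ = β ℕ.+ 8 ℕ.+ 2 ℕ.* b ℕ.+ (β ℕ.+ 3)

    0<16B : 0 ℕ.< 16 ℕ.* B
    0<16B = ℕ.*-mono-< {0} {16} {0} {B} (ℕ.s≤s ℕ.z≤n) (ℕ.m^n>0 2 β)

    0<E : 0# < fromℕ E
    0<E = fromℕ-mono-< (ℕ.*-mono-< {0} {16 ℕ.* B} {0} {4 ℕ.* b} 0<16B (ℕ.s≤s ℕ.z≤n))

    N₁    = proj₁ (o (fromℕ E ⁻¹) (⁻¹-pos 0<E))
    small = proj₂ (o (fromℕ E ⁻¹) (⁻¹-pos 0<E))

    E*s≤ : ∀ d ℓ L → d ℕ.< 2 ℕ.^ ℓ → IsLog₂ d L → fromℕ (s d) ≤ fromℕ E ⁻¹ * (fromℕ d * L) → E ℕ.* s d ℕ.≤ d ℕ.* ℓ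
    E*s≤ d ℓ L hi isLog s≤ = fromℕ-cancel-≤ (begin
      fromℕ (E ℕ.* s d)                     ≡⟨ fromℕ-* E (s d) ⟩
      fromℕ E * fromℕ (s d)                 ≤⟨ *-monoˡ-≤ _ (proj₁ 0<E) s≤ ⟩
      fromℕ E * (fromℕ E ⁻¹ * (fromℕ d * L)) ≡⟨ sym (*-assoc _ _ _) ⟩
      fromℕ E * fromℕ E ⁻¹ * (fromℕ d * L)  ≡⟨ cong (_* (fromℕ d * L)) (⁻¹-inverse 0<E) ⟩
      1# * (fromℕ d * L)                    ≡⟨ *-identityˡ _ ⟩
      fromℕ d * L                           ≤⟨ *-monoˡ-≤ _ (fromℕ-nonNeg d) (log₂-upper {d} {ℓ} hi isLog) ⟩
      fromℕ d * fromℕ ℓ                     ≡⟨ sym (fromℕ-* d ℓ) ⟩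
      fromℕ (d ℕ.* ℓ)                       ∎)
      where open ≤-Reasoning

    conclude : ∀ d ℓ → 2 ℕ.^ ℓ ℕ.≤ d → d ℕ.< 2 ℕ.^ suc ℓ → ℓ₀ ℕ.≤ ℓ → E ℕ.* s d ℕ.≤ d ℕ.* suc ℓ → ∃[ μ ] ∃[ K ]
      0 ℕ.< K × 4 ℕ.* 2 ℕ.^ (b ℕ.* K) ℕ.≤ 2 ℕ.^ μ × 2 ℕ.* s d ℕ.≤ 2 ℕ.^ μ ℕ.* K ×
      (2 ℕ.* (2 ℕ.^ β ℕ.* 2 ℕ.^ μ)) ℕ.* 4 ℕ.≤ d
    -- `K` is about ℓ/(2b): proportional to log d, yet 2^(bK) is only of order √d and so stays far
    -- below the number of blocks.
    conclude d ℓ lo hi ℓ₀≤ℓ Es≤ with multiple-above (suc ℓ) (2 ℕ.* b)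
    ... | K , 0<K , ℓ<2bK , 2bK≤ = μ , K , 0<K , few , average , degree
      where
      open ℕ.≤-Reasoning
      -- Chebyshev index k = 2BM and the bound 4k on the degree require 8BM ≤ d; this `μ` makes 8BM
      -- equal to 2^ℓ.
      μ = ℓ ℕ.∸ (β ℕ.+ 3)

      ℓ≡ : ℓ ≡ μ ℕ.+ (β ℕ.+ 3)
      ℓ≡ = sym (ℕ.m∸n+n≡m (ℕ.≤-trans (ℕ.m≤n+m (β ℕ.+ 3) (β ℕ.+ 8 ℕ.+ 2 ℕ.* b)) ℓ₀≤ℓ))

      μ-large : β ℕ.+ 8 ℕ.+ 2 ℕ.* b ℕ.≤ μ
      μ-large = ℕ.+-cancelʳ-≤ (β ℕ.+ 3) _ _ (subst (ℓ₀ ℕ.≤_) ℓ≡ ℓ₀≤ℓ)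

      M = 2 ℕ.^ μ

      2^ℓ≡ : 2 ℕ.^ ℓ ≡ 8 ℕ.* (B ℕ.* M)
      2^ℓ≡ = trans (cong (2 ℕ.^_) ℓ≡) (trans (ℕ.^-distribˡ-+-* 2 μ (β ℕ.+ 3))
        (trans (cong (M ℕ.*_) (ℕ.^-distribˡ-+-* 2 β 3)) (rearrange M B)))
        where
        rearrange : ∀ M B → M ℕ.* (B ℕ.* 8) ≡ 8 ℕ.* (B ℕ.* M)
        rearrange = solve-∀

      degree : (2 ℕ.* (B ℕ.* M)) ℕ.* 4 ℕ.≤ d
      degree = ℕ.≤-trans (ℕ.≤-reflexive (trans (rearrange (B ℕ.* M)) (sym 2^ℓ≡))) lo
        where
        rearrange : ∀ x → (2 ℕ.* x) ℕ.* 4 ≡ 8 ℕ.* x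
        rearrange = solve-∀

      few : 4 ℕ.* 2 ℕ.^ (b ℕ.* K) ℕ.≤ M
      few = subst (ℕ._≤ M) (ℕ.^-distribˡ-+-* 2 2 (b ℕ.* K)) (ℕ.^-monoʳ-≤ 2 (ℕ.*-cancelˡ-≤ {2 ℕ.+ b ℕ.* K} {μ} 2 (begin
        2 ℕ.* (2 ℕ.+ b ℕ.* K)                        ≡⟨ r₁ b K ⟩
        4 ℕ.+ 2 ℕ.* b ℕ.* K                          ≤⟨ ℕ.+-monoʳ-≤ 4 2bK≤ ⟩
        4 ℕ.+ (suc ℓ ℕ.+ 2 ℕ.* b)                    ≡⟨ cong (λ z → 4 ℕ.+ (suc z ℕ.+ 2 ℕ.* b)) ℓ≡ ⟩
        4 ℕ.+ (suc (μ ℕ.+ (β ℕ.+ 3)) ℕ.+ 2 ℕ.* b)    ≡⟨ r₂ μ β b ⟩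
        μ ℕ.+ (β ℕ.+ 8 ℕ.+ 2 ℕ.* b)                  ≤⟨ ℕ.+-monoʳ-≤ μ μ-large ⟩
        μ ℕ.+ μ                                      ≡⟨ cong (μ ℕ.+_) (sym (ℕ.+-identityʳ μ)) ⟩
        2 ℕ.* μ                                      ∎)))
        where
        r₁ : ∀ b K → 2 ℕ.* (2 ℕ.+ b ℕ.* K) ≡ 4 ℕ.+ 2 ℕ.* b ℕ.* K
        r₁ = solve-∀
        r₂ : ∀ μ β b → 4 ℕ.+ (suc (μ ℕ.+ (β ℕ.+ 3)) ℕ.+ 2 ℕ.* b) ≡ μ ℕ.+ (β ℕ.+ 8 ℕ.+ 2 ℕ.* b)
        r₂ = solve-∀

      average : 2 ℕ.* s d ℕ.≤ M ℕ.* K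
      average = ℕ.*-cancelˡ-≤ (16 ℕ.* B ℕ.* (2 ℕ.* b)) {{ℕ.>-nonZero (ℕ.*-mono-< {0} {16 ℕ.* B} {0} {2 ℕ.* b} 0<16B (ℕ.s≤s ℕ.z≤n))}} (begin
        16 ℕ.* B ℕ.* (2 ℕ.* b) ℕ.* (2 ℕ.* s d)       ≡⟨ r₁ B b (s d) ⟩
        E ℕ.* s d                                    ≤⟨ Es≤ ⟩
        d ℕ.* suc ℓ                                  ≤⟨ ℕ.*-mono-≤ (ℕ.<⇒≤ hi) ℓ<2bK ⟩
        2 ℕ.^ suc ℓ ℕ.* (2 ℕ.* b ℕ.* K)              ≡⟨ cong (λ z → 2 ℕ.* z ℕ.* (2 ℕ.* b ℕ.* K)) 2^ℓ≡ ⟩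
        2 ℕ.* (8 ℕ.* (B ℕ.* M)) ℕ.* (2 ℕ.* b ℕ.* K)  ≡⟨ r₂ B M b K ⟩
        16 ℕ.* B ℕ.* (2 ℕ.* b) ℕ.* (M ℕ.* K)         ∎)
        where
        r₁ : ∀ B b s → 16 ℕ.* B ℕ.* (2 ℕ.* b) ℕ.* (2 ℕ.* s) ≡ 16 ℕ.* B ℕ.* (4 ℕ.* b) ℕ.* s
        r₁ = solve-∀
        r₂ : ∀ B M b K → 2 ℕ.* (8 ℕ.* (B ℕ.* M)) ℕ.* (2 ℕ.* b ℕ.* K) ≡ 16 ℕ.* B ℕ.* (2 ℕ.* b) ℕ.* (M ℕ.* K)
        r₂ = solve-∀

-- Uniqueness of the joint law.

module Rectangles (em : ∀ ℓ → ExcludedMiddle ℓ) (R : CompleteOrderedField)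
                  (A B C : MeasurableSpace) {I : Set} {is : List I} (full : ∀ i → i ∈ is) where
  open RealField em R using (ℝ)
  open Regression R
  open Probability em R using (Dynkin-unique)
  open Measurability em
  open MeasurableSpace using (IsMeasurable)

  Ω : MeasurableSpace
  Ω = A ⊗ discrete I ⊗ B ⊗ C

  -- The discrete side is a singleton because `IsJointLaw` prescribes values only for single outlier
  -- sets.
  data Box : Pred (Pred (Points Ω) 0ℓ) (lsuc 0ℓ) where
    box : ∀ {P Q T} i → IsMeasurable A P → IsMeasurable B Q → IsMeasurable C T →
          Box (P ⟨×⟩ (i ≡_) ⟨×⟩ Q ⟨×⟩ T)

  box-measurable : ∀ {P} → Box P → IsMeasurable Ω P
  box-measurable (box {P} {Q} {T} i p q t) =
    basic (P , _ , p , basic ((i ≡_) , _ , _ , basic (Q , T , q , t , refl) , refl) , refl)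

  box-∩ : ∀ {P Q} → Box P → Box Q → Dynkin Box (P ∩ Q)
  box-∩ (box i p q t) (box j p′ q′ t′) with em 0ℓ {i ≡ j}
  ... | no i≢j   = resp ((λ f → ⊥-elim (f tt)) , λ { ((_ , refl , _) , (_ , refl , _)) _ → i≢j refl }) (complement whole)
  ... | yes refl = resp
    ( (λ { ((a , a′) , e , (b , b′) , (c , c′)) → (a , e , b , c) , (a′ , e , b′ , c′) })
    , λ { ((a , e , b , c) , (a′ , _ , b′ , c′)) → (a , a′) , e , (b , b′) , (c , c′) })
    (basic (box i (Closure.∩-measurable A p p′) (Closure.∩-measurable B q q′) (Closure.∩-measurable C t t′)))

  private
    𝓑 : MeasurableSpace
    𝓑 = generated Box

    -- An arbitrary set of indices is a finite union of singletons, as `is` lists all indices.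
    slab : ∀ {P Q T} (D : Pred I 0ℓ) → IsMeasurable A P → IsMeasurable B Q → IsMeasurable C T →
           IsMeasurable 𝓑 (P ⟨×⟩ D ⟨×⟩ Q ⟨×⟩ T)
    slab {P} {Q} {T} D p q t = resp
      ( (λ { (a , (e , d) , b , c) → a , d , b , c }) , λ { (a , d , b , c) → a , (refl , d) , b , c })
      (fibrewise (λ i → resp
        ( (λ { ((a , e , b , c) , d) → a , (e , subst D e d) , b , c })
        , λ { (a , (e , d) , b , c) → (a , e , b , c) , subst D (sym e) d })
        (Closure.∩-measurable 𝓑 (basic (box i p q t)) (Closure.const-measurable 𝓑 (D i)))))
      where
      fibrewise : (∀ i → IsMeasurable 𝓑 (P ⟨×⟩ ((i ≡_) ∩ D) ⟨×⟩ Q ⟨×⟩ T)) →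
                  IsMeasurable 𝓑 (λ z → (P ⟨×⟩ ((proj₁ (proj₂ z) ≡_) ∩ D) ⟨×⟩ Q ⟨×⟩ T) z)
      fibrewise h = Closure.fibrewise-measurable 𝓑 full (proj₁ ∘ proj₂)
        (λ i → resp ((λ { (_ , e , _) → sym e }) , λ e → tt , sym e , tt , tt)
          (basic (box i (MeasurableSpace.whole A) (MeasurableSpace.whole B) (MeasurableSpace.whole C))))
        (λ i → P ⟨×⟩ ((i ≡_) ∩ D) ⟨×⟩ Q ⟨×⟩ T) h

    wA = MeasurableSpace.whole A
    wB = MeasurableSpace.whole B
    wC = MeasurableSpace.whole C

  measurable⇒box-generated : MeasurableMap 𝓑 Ω id
  measurable⇒box-generated = pair-measurable 𝓑 A (discrete I ⊗ B ⊗ C)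
    (λ P p → resp (proj₁ , (_, tt , tt , tt)) (slab U p wB wC))
    (pair-measurable 𝓑 (discrete I) (B ⊗ C)
      (λ D _ → resp ((λ { (_ , d , _) → d }) , λ d → tt , d , tt , tt) (slab D wA wB wC))
      (pair-measurable 𝓑 B C
        (λ Q q → resp ((λ { (_ , _ , b , _) → b }) , λ b → tt , tt , b , tt) (slab U wA q wC))
        (λ T t → resp ((λ { (_ , _ , _ , c) → c }) , λ c → tt , tt , tt , c) (slab U wA wB t))))

  box-unique : (μ ν : ProbabilityMeasure Ω) → (∀ {P} → Box P → pr μ P ≡ pr ν P) →
               ∀ {P} → IsMeasurable Ω P → pr μ P ≡ pr ν P
  box-unique μ ν agree p = proj₂ (Dynkin-unique μ ν box-measurable agree
    (πλ.generated⇒Dynkin Box box-∩ (measurable⇒box-generated _ p)))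

-- Witnessing a large sup norm.

module Norm (em : ∀ ℓ → ExcludedMiddle ℓ) (R : CompleteOrderedField) where
  open RealField em R
  open Regression R
  open AddSupremumNonStrict _≤_ using (_≤⁺_; _≤⊤⁺; [_])
  open AddSupremumStrict _<_ using (_<⁺_; [_]; [_]<⊤⁺)

  private
    drop : ∀ {a b} → [ a ] ≤⁺ [ b ] → a ≤ b
    drop [ p ] = p

  -- The norm itself has to be exhibited: completeness supplies it when `f` is bounded, and
  -- otherwise it is infinite.
  <‖‖∞-intro : ∀ {c f} t → c < ∣ f t ∣ → c <‖ f ‖∞
  <‖‖∞-intro {c} {f} t c<ft with em 0ℓ {∃[ v ] (∀ t → ∣ f t ∣ ≤ v)}
  ... | yes (v , bound) = [ w ] , record
      { upper = λ { _ (t , refl) → [ IsLub.upper lub _ (t , refl) ] }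
      ; least = λ { ⊤⁺ h → [ w ] ≤⊤⁺ ; [ v ] h → [ IsLub.least lub v (λ { _ (t , refl) → drop (h _ (t , refl)) }) ] }
      } , [ <-≤-trans c<ft (IsLub.upper lub _ (t , refl)) ]
    where
    sup = complete (λ r → ∃[ t ] r ≡ ∣ f t ∣) (_ , t , refl) (v , λ { _ (t , refl) → bound t })
    w   = proj₁ sup
    lub = proj₂ sup
  ... | no unbounded = ⊤⁺ , record
      { upper = λ { _ (t , refl) → [ _ ] ≤⊤⁺ }
      ; least = λ { ⊤⁺ h → ⊤⁺ ≤⊤⁺ ; [ v ] h → ⊥-elim (unbounded (v , λ t → drop (h _ (t , refl)))) }
      } , [ c ]<⊤⁺

  -- The proofs stored in a refinement are irrelevant; deciding the proposition by excluded middle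
  -- recovers them.
  bounds : (t : [-1,1]) → (- 1# ≤ value t) × (value t ≤ 1#)
  bounds (t , [ p ]) = recompute (em 0ℓ) p

-- The game between algorithm and adversary.

erase : ∀ {m} → Maybe (Fin m) → Vec Bool m → Vec Bool m
erase nothing  ε = ε
erase (just j) ε = ε [ j ]≔ false

Vec-ext : ∀ {A : Set} {n} {v w : Vec A n} → (∀ i → lookup v i ≡ lookup w i) → v ≡ w
Vec-ext {v = v} {w} eq = trans (sym (tabulate∘lookup v)) (trans (tabulate-cong eq) (tabulate∘lookup w))

module Game (em : ∀ ℓ → ExcludedMiddle ℓ) (R : CompleteOrderedField) {m : ℕ} (0<m : 0 ℕ.< m)
            {k d : ℕ} (4k≤d : k ℕ.* 4 ℕ.≤ d) (n : ℕ) where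
  open RealField em R
  open Solver
  open Regression R
  open Measurability em
  open Probability em R
  open Chebyshev em R hiding (T)
  open Blocks m 0<m hiding (M)
  open Exposure em R
  open Norm em R
  open MeasurableSpace using (IsMeasurable)

  abstract
    q : Fin m → Poly d
    q j = proj₁ (represented-pad (ℕ.s≤s 4k≤d) (peak k j , λ _ → refl))

    eval-q : ∀ j t → eval (q j) t ≡ eval (peak k j) t
    eval-q j = proj₂ (represented-pad (ℕ.s≤s 4k≤d) (peak k j , λ _ → refl))

  select : ∀ {m n} → Vec Bool m → (Fin m → Vec ℝ n) → Vec ℝ n
  select []          q = replicate _ 0#
  select (true  ∷ ε) q = q zero +ᵖ select ε (q ∘ suc)
  select (false ∷ ε) q = select ε (q ∘ suc)

  eval-select : ∀ {m n} (ε : Vec Bool m) (q : Fin m → Vec ℝ n) j t →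
    eval (select (ε [ j ]≔ true) q) t ≡ eval (select (ε [ j ]≔ false) q) t + eval (q j) t
  eval-select (_     ∷ ε) q zero    t = trans (eval-+ᵖ (q zero) _ t) (+-comm _ _)
  eval-select (true  ∷ ε) q (suc j) t = begin
    eval (q zero +ᵖ select (ε [ j ]≔ true) (q ∘ suc)) t
      ≡⟨ eval-+ᵖ (q zero) _ t ⟩
    eval (q zero) t + eval (select (ε [ j ]≔ true) (q ∘ suc)) t
      ≡⟨ cong (eval (q zero) t +_) (eval-select ε (q ∘ suc) j t) ⟩
    eval (q zero) t + (eval (select (ε [ j ]≔ false) (q ∘ suc)) t + eval (q (suc j)) t)
      ≡⟨ sym (+-assoc _ _ _) ⟩
    eval (q zero) t + eval (select (ε [ j ]≔ false) (q ∘ suc)) t + eval (q (suc j)) t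
      ≡⟨ cong (_+ eval (q (suc j)) t) (sym (eval-+ᵖ (q zero) _ t)) ⟩
    eval (q zero +ᵖ select (ε [ j ]≔ false) (q ∘ suc)) t + eval (q (suc j)) t ∎
    where open ≡-Reasoning
  eval-select (false ∷ ε) q (suc j) t = eval-select ε (q ∘ suc) j t

  label : [-1,1] → Maybe (Fin m)
  label t with em 0ℓ {∃[ j ] InBlock j (value t)}
  ... | yes (j , _) = just j
  ... | no _        = nothing

  -- Excluded middle picks some block containing the point; disjointness identifies it with the
  -- given one.
  label-just : ∀ {j t} → InBlock j (value t) → label t ≡ just j
  label-just {j} {t} p with em 0ℓ {∃[ j ] InBlock j (value t)}
  ... | yes (k , q) = cong just (InBlock-unique k j q p)
  ... | no none     = ⊥-elim (none (j , p))

  label-just⁻ : ∀ {j t} → label t ≡ just j → InBlock j (value t)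
  label-just⁻ {j} {t} eq with em 0ℓ {∃[ j ] InBlock j (value t)} | eq
  ... | yes (k , q) | refl = q

  Labels : Set
  Labels = Vec (Maybe (Fin m)) n

  labels : Vec [-1,1] n → Labels
  labels = Vec.map label

  all-labels : List Labels
  all-labels = vectors (nothing ∷ List.map just (List.allFin m)) n

  ∈-all-labels : ∀ a → a ∈ all-labels
  ∈-all-labels = ∈-vectors λ { nothing → here refl ; (just j) → there (∈-map⁺ just (∈-allFin j)) }

  ∈-bits : ∀ {n} (v : Vec Bool n) → v ∈ bits n
  ∈-bits = ∈-vectors λ { false → here refl ; true → there (here refl) }

  -- The block whose coefficient the adversary hides: all of its samples are outliers.
  hidden : Labels → Subset n → Maybe (Fin m)
  hidden a S = first (live a S (replicate m true))

  poly : Vec Bool m → Poly d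
  poly ε = select ε q

  answer : Vec Bool m → Labels → Subset n → Poly d
  answer ε a S = poly (erase (hidden a S) ε)

  sample : Poly d → Vec [-1,1] n → Vec ℝ n
  sample p = Vec.map (λ t → eval p (value t))

  respond : Vec Bool m → Vec [-1,1] n → Subset n → Vec ℝ n
  respond ε x S = sample (answer ε (labels x) S) x

  outside-small : ∀ j (t : [-1,1]) → ¬ InBlock j (value t) → ∣ eval (q j) (value t) ∣ ≤ 1#
  outside-small j t out = subst (λ z → ∣ z ∣ ≤ 1#) (sym (eval-q j (value t)))
    (peak-small k j (proj₁ (bounds t)) (proj₂ (bounds t)) out)

  -- Erasing a single bit changes the polynomial by 0 or by one peak, and the point lies outside the
  -- block of that peak.
  erase-small : ∀ ε h (t : [-1,1]) → (∀ j → h ≡ just j → ¬ InBlock j (value t)) →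
                ∣ eval (poly (erase h ε)) (value t) - eval (poly ε) (value t) ∣ ≤ 1#
  erase-small ε nothing t out = subst (λ z → ∣ z ∣ ≤ 1#) (sym (-‿inverseʳ _))
    (∣∣-≤ 0≤1 (≤-trans (≤-reflexive (solve 0 (:- :0 := :0) refl)) 0≤1))
  erase-small ε (just j) t out with lookup ε j in eq
  ... | false = subst (λ e → ∣ eval (poly (ε [ j ]≔ false)) (value t) - eval (poly e) (value t) ∣ ≤ 1#)
    (trans (cong (ε [ j ]≔_) (sym eq)) ([]≔-lookup ε j)) (subst (λ z → ∣ z ∣ ≤ 1#) (sym (-‿inverseʳ _))
      (∣∣-≤ 0≤1 (≤-trans (≤-reflexive (solve 0 (:- :0 := :0) refl)) 0≤1)))
  ... | true = subst (λ e → ∣ p₀ - eval (poly e) (value t) ∣ ≤ 1#)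
    (trans (cong (ε [ j ]≔_) (sym eq)) ([]≔-lookup ε j))
    (subst (λ z → ∣ p₀ - z ∣ ≤ 1#) (sym (eval-select ε q j (value t)))
      (∣∣-≤ (≤-trans (≤-reflexive (solve 2 (λ p v → p :- (p :+ v) := :- v) refl p₀ v)) (≤-trans (-x≤∣x∣ v) small))
            (≤-trans (≤-reflexive (solve 2 (λ p v → :- (p :- (p :+ v)) := v) refl p₀ v)) (≤-trans (x≤∣x∣ v) small))))
    where
    p₀ = eval (poly (ε [ j ]≔ false)) (value t)
    v  = eval (q j) (value t)
    small = outside-small j t (out j refl)

  respond-bounded : ∀ ε x S i → i ∉ S → ∣ lookup (respond ε x S) i - eval (poly ε) (value (lookup x i)) ∣ ≤ 1#
  respond-bounded ε x S i i∉S = subst (λ z → ∣ z - eval (poly ε) (value (lookup x i)) ∣ ≤ 1#) (sym (lookup-map i _ x))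
    (erase-small ε (hidden (labels x) S) (lookup x i) λ j eq inBlock → i∉S (lookup⇒[]= i S
      (live-outlier (labels x) S (replicate m true) (first-true (live (labels x) S (replicate m true)) eq) i (trans (lookup-map i label x) (label-just inBlock)))))

  -- Blocks are open, and having no label is a finite intersection of their complements.
  labels-measurable : ∀ a → IsMeasurable (Cube n) (λ x → labels x ≡ a)
  labels-measurable a = resp
    ( (λ {x} eq → Vec-ext λ i → trans (lookup-map i label x) (eq i))
    , λ {x} eq i → trans (sym (lookup-map i label x)) (cong (λ v → lookup v i) eq))
    (∀Fin-measurable (λ i x → label (lookup x i) ≡ lookup a i) λ i → entry i (lookup a i))
    where
    open Closure (Cube n)
    block : ∀ i j → IsMeasurable (Cube n) (λ x → InBlock j (value (lookup x i)))
    block i j = basic (lift λ x p → let (r , 0<r , near) = InBlock-open j _ p in r , 0<r , λ y y-near →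
      near _ (subst₂ (λ a b → ∣ a - b ∣ < r) (lookup-map i value y) (lookup-map i value x) (y-near i)))
    entry : ∀ i c → IsMeasurable (Cube n) (λ x → label (lookup x i) ≡ c)
    entry i (just j) = resp (label-just , label-just⁻) (block i j)
    entry i nothing  = resp
      ( (λ {x} out → case-label (lookup x i) out)
      , λ {x} eq j p → contradiction (trans (sym eq) (label-just {j} {lookup x i} p)) λ ())
      (∀Fin-measurable (λ j x → ¬ InBlock j (value (lookup x i))) λ j → complement (block i j))
      where
      case-label : ∀ (t : [-1,1]) → (∀ j → ¬ InBlock j (value t)) → label t ≡ nothing
      case-label t out with em 0ℓ {∃[ j ] InBlock j (value t)}
      ... | yes (j , p) = ⊥-elim (out j p)
      ... | no _        = refl

  ∣value∣≤1 : ∀ (t : [-1,1]) → ∣ value t ∣ ≤ 1#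
  ∣value∣≤1 t = ∣∣-≤ (proj₂ (bounds t)) (subst (- value t ≤_) (solve 0 (:- (:- :1) := :1) refl) (neg-mono-≤ (proj₁ (bounds t))))

  -- Continuity by the Lipschitz bound; `1# + l` replaces `l` to keep the divisor positive.
  sample-open : ∀ p {Q} → IsOpen id Q → IsOpen (Vec.map value) (sample p ⊢ Q)
  sample-open p {Q} open-Q x Qx with lipschitz p | open-Q _ Qx
  ... | _ , l , _ , 0≤l , _ , lip | r , 0<r , near = r * (1# + l) ⁻¹ , *-pos 0<r (⁻¹-pos 0<1+l) , λ y y-near →
    near _ λ i → subst₂ (λ a b → ∣ a - b ∣ < r) (sym (lookup-map i _ y)) (sym (lookup-map i _ x))
      (close (lookup y i) (lookup x i) (subst₂ (λ a b → ∣ a - b ∣ < r * (1# + l) ⁻¹) (lookup-map i value y) (lookup-map i value x) (y-near i)))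
    where
    0<1+l : 0# < 1# + l
    0<1+l = +-pos-nonNeg 0<1 0≤l
    close : ∀ s t → ∣ value s - value t ∣ < r * (1# + l) ⁻¹ → ∣ eval p (value s) - eval p (value t) ∣ < r
    close s t st = ≤-<-trans (lip (∣value∣≤1 s) (∣value∣≤1 t)) (≤-<-trans
      (*-monoʳ-≤ _ (∣∣-nonNeg _) (≤-diff (subst (0# ≤_) (solve 1 (λ l → :1 := :1 :+ l :- l) refl l) 0≤1)))
      (subst ((1# + l) * ∣ value s - value t ∣ <_)
        (trans (solve 3 (λ e r i → e :* (r :* i) := r :* (e :* i)) refl (1# + l) r ((1# + l) ⁻¹))
          (trans (cong (r *_) (⁻¹-inverse 0<1+l)) (*-identityʳ r)))
        (*-monoˡ-< 0<1+l st)))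

  module _ (N : MeasurableSpace) where
    private
      M : MeasurableSpace
      M = Cube n ⊗ discrete (Subset n) ⊗ N

    points-measurable : MeasurableMap M (Cube n) proj₁
    points-measurable = proj₁-measurable (Cube n) (discrete (Subset n) ⊗ N)

    outliers-measurable : MeasurableMap M (discrete (Subset n)) (proj₁ ∘ proj₂)
    outliers-measurable P p = proj₂-measurable (Cube n) (discrete (Subset n) ⊗ N) _ (proj₁-measurable (discrete (Subset n)) N P p)

    -- Block membership makes the response discontinuous, but once the labels and the outlier set
    -- are fixed the answer is one polynomial, continuous in the points. There are finitely many
    -- such pieces.
    respond-measurable : ∀ ε → MeasurableMap M (Space n) (λ (x , S , _) → respond ε x S)
    respond-measurable ε = generated-measurable M λ { Q (lift open-Q) →
      fibrewise-measurable ∈-all-labels (labels ∘ proj₁) (λ a → points-measurable _ (labels-measurable a))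
        (λ a (x , S , _) → Q (sample (answer ε a S) x)) λ a →
      fibrewise-measurable ∈-bits (proj₁ ∘ proj₂) (λ S → outliers-measurable (_≡ S) _)
        (λ S (x , _) → Q (sample (answer ε a S) x)) λ S →
      points-measurable _ (basic (lift (sample-open (answer ε a S) open-Q))) }
      where open Closure M

  exposed-measurable : ∀ S → IsMeasurable (Cube n) (λ x → ∃[ j ] hidden (labels x) S ≡ just j)
  exposed-measurable S = fibrewise-measurable ∈-all-labels labels labels-measurable
    (λ a _ → ∃[ j ] hidden a S ≡ just j) (λ a → const-measurable _)
    where open Closure (Cube n)

  ∑-none : ∀ n (P : Vec Bool n → Set) → (∀ v → ¬ P v) → ∑ (bits n) (λ v → 𝟙 (P v)) ≡ 0#
  ∑-none n P ¬P = trans (∑-cong (bits n) λ v → trans (𝟙-no (¬P v)) (sym (zeroˡ 0#))) (trans (∑-*ˡ 0# (bits n) (λ _ → 0#)) (zeroˡ _))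

  ∑-unique : ∀ {n} (P : Vec Bool n → Set) w → (∀ v → P v → w ≡ v) → ∑ (bits n) (λ v → 𝟙 (P v)) ≡ 𝟙 (P w)
  ∑-unique P [] h = +-identityʳ _
  ∑-unique {suc n} P (false ∷ w) h = trans (∑-bits n _) (trans (cong₂ _+_
    (∑-unique (P ∘ (false ∷_)) w λ v p → cong Vec.tail (h _ p))
    (∑-none n (P ∘ (true ∷_)) λ v p → contradiction (cong Vec.head (h _ p)) λ ())) (+-identityʳ _))
  ∑-unique {suc n} P (true ∷ w) h = trans (∑-bits n _) (trans (cong₂ _+_
    (∑-none n (P ∘ (false ∷_)) λ v p → contradiction (cong Vec.head (h _ p)) λ ())
    (∑-unique (P ∘ (true ∷_)) w λ v p → cong Vec.tail (h _ p))) (+-identityˡ _))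

  module _ (alg : Algorithm d n) where
    open Algorithm alg using (Seed; seedLaw; estimate)

    -- The adversary is deterministic, so its seed is irrelevant; the algorithm's seed space serves as a dummy.
    adversary : ∀ ε → Adversary n (poly ε) 1#
    adversary ε = record
      { Seed       = Seed
      ; seedLaw    = seedLaw
      ; respond    = λ x S _ → respond ε x S
      ; bounded    = λ x S _ i i∉S → respond-bounded ε x S i i∉S
      ; measurable = respond-measurable Seed ε
      }

    Ω : MeasurableSpace
    Ω = Cube n ⊗ discrete (Subset n) ⊗ Seed ⊗ Seed

    Fails : ℝ → Vec Bool m → Pred (Points Ω) 0ℓ
    Fails C ε = Failure alg (adversary ε) C

    Fails-measurable : ∀ C ε → IsMeasurable Ω (Fails C ε)
    Fails-measurable C ε = pair-measurable Ω (Cube n) (Space n ⊗ Seed) (points-measurable (Seed ⊗ Seed))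
      (pair-measurable Ω (Space n) Seed (respond-measurable (Seed ⊗ Seed) ε)
        (λ P p → proj₂-measurable (Cube n) (discrete (Subset n) ⊗ Seed ⊗ Seed) _
          (proj₂-measurable (discrete (Subset n)) (Seed ⊗ Seed) _ (proj₁-measurable Seed Seed P p))))
      _ (Algorithm.measurable alg 1# (poly ε) (C * 1#))

    -- Neither the outcome space nor the prescribed values on boxes depend on ε.
    law-unique : ∀ ρ 𝒟 ε ε′ μ ν → IsJointLaw alg (adversary ε) ρ 𝒟 μ → IsJointLaw alg (adversary ε′) ρ 𝒟 ν →
                 ∀ {P} → IsMeasurable Ω P → pr μ P ≡ pr ν P
    law-unique ρ 𝒟 ε ε′ μ ν law-μ law-ν = box-unique μ ν
      λ { (box S p q t) → trans (law-μ _ S _ _ p q t) (sym (law-ν _ S _ _ p q t)) }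
      where open Rectangles em R (Cube n) Seed Seed ∈-bits

    module _ {C : ℝ} (tall : C + C < 1# + fromℕ k * fromℕ k * η) where

      Fails-intro : ∀ ε {a x S u v} t → answer ε (labels x) S ≡ a →
        C * 1# < ∣ error (estimate 1# x (sample a x) u) (poly ε) t ∣ → Fails C ε (x , S , u , v)
      Fails-intro ε t refl lt = <‖‖∞-intro t lt

      -- Both values of bit `j` yield the same samples, hence the same estimate. Were it within `C`
      -- of both polynomials at the centre, the triangle inequality would bound the peak there by
      -- `C + C`, against `tall`.
      one-fails : ∀ ε j ((x , S , u , v) : Points Ω) → hidden (labels x) S ≡ just j →
                  Fails C (ε [ j ]≔ false) (x , S , u , v) ⊎ Fails C (ε [ j ]≔ true) (x , S , u , v)
      one-fails ε j (x , S , u , v) eq = cases (em 0ℓ) (em 0ℓ)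
        where
        t : [-1,1]
        t = centre j , [ centre-lower j , centre-upper j ]
        p̂ : ℝ
        p̂ = estimate 1# x (sample (poly (ε [ j ]≔ false)) x) u t
        p₀ = eval (poly (ε [ j ]≔ false)) (centre j)
        v₀ = eval (q j) (centre j)

        same-answer : ∀ b → answer (ε [ j ]≔ b) (labels x) S ≡ poly (ε [ j ]≔ false)
        same-answer b = trans (cong (λ h → poly (erase h (ε [ j ]≔ b))) eq) (cong poly ([]≔-idempotent ε j))

        fail : ∀ b e → eval (poly (ε [ j ]≔ b)) (centre j) ≡ e → C * 1# < ∣ p̂ - e ∣ → Fails C (ε [ j ]≔ b) (x , S , u , v)
        fail b e refl lt = Fails-intro (ε [ j ]≔ b) {poly (ε [ j ]≔ false)} {x} {S} {u} {v} t (same-answer b) lt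

        cases : Dec (C * 1# < ∣ p̂ - p₀ ∣) → Dec (C * 1# < ∣ p̂ - (p₀ + v₀) ∣) →
                Fails C (ε [ j ]≔ false) (x , S , u , v) ⊎ Fails C (ε [ j ]≔ true) (x , S , u , v)
        cases (yes lt) _        = inj₁ (fail false p₀ refl lt)
        cases (no _)   (yes lt) = inj₂ (fail true (p₀ + v₀) (eval-select ε q j (centre j)) lt)
        cases (no ≮₀)  (no ≮₁)  = ⊥-elim (<⇒≱ tall (begin
          1# + fromℕ k * fromℕ k * η           ≤⟨ peak-centre k j ⟩
          eval (peak k j) (centre j)           ≡⟨ sym (eval-q j (centre j)) ⟩
          v₀                                   ≡⟨ solve 3 (λ p v e → v := (e :- p) :+ (:- (e :- (p :+ v)))) refl p₀ v₀ p̂ ⟩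
          (p̂ - p₀) + (- (p̂ - (p₀ + v₀)))       ≤⟨ +-mono-≤ (≤-trans (x≤∣x∣ _) (≮⇒≥ ≮₀)) (≤-trans (-x≤∣x∣ _) (≮⇒≥ ≮₁)) ⟩
          C * 1# + C * 1#                      ≡⟨ cong (λ z → z + z) (*-identityʳ C) ⟩
          C + C                                ∎))
          where open ≤-Reasoning

      -- Exposure is split by outlier set so that each piece is a box, whose probability the joint
      -- law gives directly.
      Exposed : Subset n → Pred (Points Ω) 0ℓ
      Exposed S = (λ x → ∃[ j ] hidden (labels x) S ≡ just j) ⟨×⟩ (S ≡_) ⟨×⟩ U ⟨×⟩ U

      Exposed-measurable : ∀ S → IsMeasurable Ω (Exposed S)
      Exposed-measurable S = Rectangles.box-measurable em R (Cube n) Seed Seed ∈-bits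
        (Rectangles.box S (exposed-measurable S) (MeasurableSpace.whole Seed) (MeasurableSpace.whole Seed))

      -- Only the actual outlier set contributes on the left. If a block is hidden, that block
      -- depends on the labels and outliers but not on ε, so `∑-pairs` applies to its bit.
      exposed-fails : ∀ ω → ones m * ∑ (bits n) (λ S → 𝟙 (Exposed S ω)) ≤
                            ∑ (bits m) (λ ε → 𝟙 (Fails C ε ω)) + ∑ (bits m) (λ ε → 𝟙 (Fails C ε ω))
      exposed-fails ω@(x , S , u , v) = subst (λ z → ones m * z ≤ F + F)
        (sym (∑-unique (λ S′ → Exposed S′ ω) S λ { _ (_ , refl , _) → refl })) (cases (em 0ℓ))
        where
        f : Vec Bool m → ℝ
        f ε = 𝟙 (Fails C ε ω)
        F : ℝ
        F = ∑ (bits m) f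
        0≤f : ∀ ε → 0# ≤ f ε
        0≤f ε = 𝟙-nonNeg (Fails C ε ω)
        0≤F : 0# ≤ F
        0≤F = subst (_≤ F) (∑-none m (λ _ → ⊥) (λ _ ()))
          (∑-mono (bits m) λ ε → subst (_≤ f ε) (sym (𝟙-no id)) (0≤f ε))
        pair : ∀ j → hidden (labels x) S ≡ just j → ∀ ε → 1# ≤ f (ε [ j ]≔ false) + f (ε [ j ]≔ true)
        pair j eq ε =
          [ (λ p → subst (_≤ f (ε [ j ]≔ false) + f (ε [ j ]≔ true)) (+-identityʳ 1#)
              (+-mono-≤ (≤-reflexive (sym (𝟙-yes p))) (0≤f (ε [ j ]≔ true))))
          , (λ p → subst (_≤ f (ε [ j ]≔ false) + f (ε [ j ]≔ true)) (+-identityˡ 1#)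
              (+-mono-≤ (0≤f (ε [ j ]≔ false)) (≤-reflexive (sym (𝟙-yes p)))))
          ]′ (one-fails ε j ω eq)
        cases : Dec (Exposed S ω) → ones m * 𝟙 (Exposed S ω) ≤ F + F
        cases (yes e@((j , eq) , _)) = subst (λ z → ones m * z ≤ F + F) (sym (𝟙-yes e))
          (subst (_≤ F + F) (sym (*-identityʳ _)) (∑-pairs j f (pair j eq)))
        cases (no ¬e) = subst (λ z → ones m * z ≤ F + F) (sym (𝟙-no ¬e)) (subst (_≤ F + F) (sym (zeroʳ _)) (+-nonNeg 0≤F 0≤F))

      -- The pointwise inequality is gathered into one combination of indicators, with weight 2 on
      -- failures and `- ones m` on exposures, and integrated against the lower bound 0.
      exposed-fails-pr : ∀ (ℙ : ProbabilityMeasure Ω) →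
        ones m * ∑ (bits n) (λ S → pr ℙ (Exposed S)) ≤ ∑ (bits m) (λ ε → pr ℙ (Fails C ε)) + ∑ (bits m) (λ ε → pr ℙ (Fails C ε))
      exposed-fails-pr ℙ = ≤-diff (subst (0# ≤_) (collapse (λ i → pr ℙ (X i)))
        (integrate ℙ (List.map inj₁ (bits m) ++ List.map inj₂ (bits n)) w X
          (λ { (inj₁ ε) → Fails-measurable C ε ; (inj₂ S) → Exposed-measurable S }) 0#
          λ ω → subst (0# ≤_) (sym (collapse (λ i → 𝟙 (X i ω)))) (diff-≤ (exposed-fails ω))))
        where
        w : Vec Bool m ⊎ Subset n → ℝ
        w (inj₁ ε) = 1# + 1#
        w (inj₂ S) = - ones m
        X : Vec Bool m ⊎ Subset n → Pred (Points Ω) 0ℓ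
        X (inj₁ ε) = Fails C ε
        X (inj₂ S) = Exposed S
        collapse : ∀ (f : Vec Bool m ⊎ Subset n → ℝ) →
          ∑ (List.map inj₁ (bits m) ++ List.map inj₂ (bits n)) (λ i → w i * f i)
            ≡ ∑ (bits m) (f ∘ inj₁) + ∑ (bits m) (f ∘ inj₁) - ones m * ∑ (bits n) (f ∘ inj₂)
        collapse f = begin
          ∑ (List.map inj₁ (bits m) ++ List.map inj₂ (bits n)) (λ i → w i * f i)
            ≡⟨ ∑-++ (List.map inj₁ (bits m)) _ _ ⟩
          ∑ (List.map inj₁ (bits m)) (λ i → w i * f i) + ∑ (List.map inj₂ (bits n)) (λ i → w i * f i)
            ≡⟨ cong₂ _+_ (trans (∑-map inj₁ (bits m) _) (∑-*ˡ _ (bits m) _)) (trans (∑-map inj₂ (bits n) _) (∑-*ˡ _ (bits n) _)) ⟩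
          (1# + 1#) * ∑ (bits m) (f ∘ inj₁) + (- ones m) * ∑ (bits n) (f ∘ inj₂)
            ≡⟨ solve 3 (λ a o b → (:1 :+ :1) :* a :+ (:- o) :* b := a :+ a :- o :* b) refl _ (ones m) _ ⟩
          ∑ (bits m) (f ∘ inj₁) + ∑ (bits m) (f ∘ inj₁) - ones m * ∑ (bits n) (f ∘ inj₂) ∎
          where open ≡-Reasoning

      module _ {ρ : ℝ} (0≤ρ : 0# ≤ ρ) (ρ≤1 : ρ ≤ 1#) {b K : ℕ} (1≤ρ2ᵇ : 1# ≤ ρ * fromℕ (2 ℕ.^ b)) (0<K : 0 ℕ.< K)
               (4·2ᵇᴷ≤m : 4 ℕ.* 2 ℕ.^ (b ℕ.* K) ℕ.≤ m) (2n≤mK : 2 ℕ.* n ℕ.≤ m ℕ.* K)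
               (𝒟 : ProbabilityMeasure (Cube n)) where

        -- The joint law factors on boxes, so the bound that `exposed-likely` gives for each tuple
        -- of points is integrated over `𝒟` alone.
        exposed-pr : ∀ ε ℙ → IsJointLaw alg (adversary ε) ρ 𝒟 ℙ → fromℕ 2 ≤ fromℕ 3 * ∑ (bits n) (λ S → pr ℙ (Exposed S))
        exposed-pr ε ℙ law = subst (fromℕ 2 ≤_) (trans (∑-cong (bits n) rectangle) (∑-*ˡ (fromℕ 3) (bits n) _))
          (integrate 𝒟 (bits n) (λ S → fromℕ 3 * outlierWeight ρ S) _ exposed-measurable (fromℕ 2) λ x →
            subst (fromℕ 2 ≤_) (trans (sym (∑-*ˡ (fromℕ 3) (bits n) _)) (∑-cong (bits n) λ S → sym (*-assoc (fromℕ 3) _ _)))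
              (exposed-likely ρ 0≤ρ ρ≤1 b K 1≤ρ2ᵇ 0<K 4·2ᵇᴷ≤m 2n≤mK (labels x)))
          where
          rectangle : ∀ S → fromℕ 3 * outlierWeight ρ S * pr 𝒟 (λ x → ∃[ j ] hidden (labels x) S ≡ just j) ≡ fromℕ 3 * pr ℙ (Exposed S)
          rectangle S = trans (solve 3 (λ t w e → t :* w :* e := t :* (e :* (w :* (:1 :* :1)))) refl (fromℕ 3) (outlierWeight ρ S) _)
            (cong (fromℕ 3 *_) (sym (trans (law _ S U U (exposed-measurable S) (MeasurableSpace.whole Seed) (MeasurableSpace.whole Seed))
              (cong (λ z → pr 𝒟 _ * (outlierWeight ρ S * (z * z))) (ProbabilityMeasure.pr-whole seedLaw)))))

        Robust : Vec Bool m → Set₁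
        Robust ε = (ℙ : ProbabilityMeasure Ω) → IsJointLaw alg (adversary ε) ρ 𝒟 ℙ → fromℕ 4 ⁻¹ < pr ℙ (Fails C ε)

        module AllFail (none : ¬ (∃[ ε ] Robust ε)) where
          bad-law : ∀ ε → Σ[ ℙ ∈ ProbabilityMeasure Ω ] IsJointLaw alg (adversary ε) ρ 𝒟 ℙ × pr ℙ (Fails C ε) ≤ fromℕ 4 ⁻¹
          bad-law ε = decidable-stable (em (lsuc 0ℓ)) λ good → none (ε , λ ℙ law → ≰⇒> λ p → good (ℙ , law , p))

          ε₀ : Vec Bool m
          ε₀ = replicate m false
          ℙ₀ = proj₁ (bad-law ε₀)
          law₀ = proj₁ (proj₂ (bad-law ε₀))
          E = ∑ (bits n) (λ S → pr ℙ₀ (Exposed S))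

          -- Each bound holds under its own law; `law-unique` moves all of them to `ℙ₀`, under which
          -- they can be added.
          quarter : ∑ (bits m) (λ ε → pr ℙ₀ (Fails C ε)) ≤ fromℕ 4 ⁻¹ * ones m
          quarter = subst (∑ (bits m) (λ ε → pr ℙ₀ (Fails C ε)) ≤_) (∑-*ˡ (fromℕ 4 ⁻¹) (bits m) (λ _ → 1#)) (∑-mono (bits m) λ ε →
            let (ℙ , law , p) = bad-law ε in
            subst₂ _≤_ (law-unique ρ 𝒟 ε ε₀ ℙ ℙ₀ law law₀ (Fails-measurable C ε)) (sym (*-identityʳ _)) p)

          absurd : ⊥
          -- Multiplying 2/3 ≤ 1/2 by 12 clears the denominators, which turns it into 8 ≤ 6.
          absurd = <⇒≱ (*-monoˡ-< (ones-pos m) (fromℕ-mono-< (ℕ.n≤1+n 7))) (begin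
            ones m * fromℕ 8                                     ≡⟨ solve 1 (λ o → o :* :8 := :4 :* (o :* :2)) refl (ones m) ⟩
            fromℕ 4 * (ones m * fromℕ 2)                         ≤⟨ *-monoˡ-≤ _ (fromℕ-nonNeg 4) (*-monoˡ-≤ _ (proj₁ (ones-pos m)) (exposed-pr ε₀ ℙ₀ law₀)) ⟩
            fromℕ 4 * (ones m * (fromℕ 3 * E))                   ≡⟨ solve 4 (λ f o t e → f :* (o :* (t :* e)) := f :* t :* (o :* e)) refl (fromℕ 4) (ones m) (fromℕ 3) E ⟩
            fromℕ 4 * fromℕ 3 * (ones m * E)                     ≤⟨ *-monoˡ-≤ _ (*-nonNegative _ _ (fromℕ-nonNeg 4) (fromℕ-nonNeg 3)) (≤-trans (exposed-fails-pr ℙ₀) (+-mono-≤ quarter quarter)) ⟩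
            fromℕ 4 * fromℕ 3 * (fromℕ 4 ⁻¹ * ones m + fromℕ 4 ⁻¹ * ones m)
              ≡⟨ solve 4 (λ f t i o → f :* t :* (i :* o :+ i :* o) := (f :* i) :* (o :* (t :+ t))) refl (fromℕ 4) (fromℕ 3) (fromℕ 4 ⁻¹) (ones m) ⟩
            fromℕ 4 * fromℕ 4 ⁻¹ * (ones m * (fromℕ 3 + fromℕ 3)) ≡⟨ cong₂ (λ a b → a * (ones m * b)) (⁻¹-inverse (fromℕ-pos 3)) (sym (fromℕ-+ 3 3)) ⟩
            1# * (ones m * fromℕ 6)                              ≡⟨ *-identityˡ _ ⟩
            ones m * fromℕ 6                                     ∎)
            where
            open ≤-Reasoning
            :2 :4 :8 : ∀ {n} → Polynomial n
            :2 = :1 :+ (:1 :+ :0)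
            :4 = :1 :+ (:1 :+ :2)
            :8 = :1 :+ (:1 :+ (:1 :+ (:1 :+ :4)))

        -- If no ε works, all the joint laws coincide, and averaging over ε gives 2/3 ≤ 1/2.
        some-ε-fails : ∃[ ε ] Robust ε
        some-ε-fails = decidable-stable (em (lsuc 0ℓ)) AllFail.absurd

-- Constants and conclusion.

module Parameters (em : ∀ ℓ → ExcludedMiddle ℓ) (R : CompleteOrderedField) where
  open RealField em R
  open Solver
  open Logarithm

  fromℕ≤2^ : ∀ n → fromℕ n ≤ fromℕ (2 ℕ.^ n)
  fromℕ≤2^ n = fromℕ-mono-≤ (ℕ.<⇒≤ (n<2^n n))

  power-above : ∀ C → ∃[ β ] C ≤ fromℕ (2 ℕ.^ β)
  power-above C = let (n , p) = archimedean C in n , ≤-trans p (fromℕ≤2^ n)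

  -- The exponent is a successor because `choose-blocks` divides by twice its value.
  power-inverse : ∀ {ρ} → 0# < ρ → ∃[ b ] 1# ≤ ρ * fromℕ (2 ℕ.^ suc b)
  power-inverse {ρ} 0<ρ = let (b , p) = power-above (ρ ⁻¹) in b ,
    subst (_≤ ρ * fromℕ (2 ℕ.^ suc b)) (⁻¹-inverse 0<ρ) (*-monoˡ-≤ ρ (proj₁ 0<ρ)
      (≤-trans p (fromℕ-mono-≤ {2 ℕ.^ b} {2 ℕ.^ suc b} (ℕ.^-monoʳ-≤ 2 (ℕ.n≤1+n b)))))

  -- With k = 2Bm and η = 1/(2m²) one gets k²η = 2B², at least 2C because B ≥ C ≥ 1; the summand 1
  -- makes the inequality strict.
  peak-tall : ∀ {C} B m (0<m : 0 ℕ.< m) → 1# ≤ C → C ≤ fromℕ B → let k = 2 ℕ.* (B ℕ.* m) in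
    C + C < 1# + fromℕ k * fromℕ k * Chebyshev.Blocks.η em R m 0<m
  peak-tall {C} B m 0<m 1≤C C≤B = ≤-<-trans
    (≤-trans (+-mono-≤ C≤BB C≤BB) (≤-reflexive (sym k²η)))
    (<-diff (subst (0# <_) (solve 1 (λ x → :1 := :1 :+ x :- x) refl _) 0<1))
    where
    open Chebyshev.Blocks em R m 0<m using (M; η; η-inverse)
    k = 2 ℕ.* (B ℕ.* m)
    B′ = fromℕ B
    C≤BB : C ≤ B′ * B′
    C≤BB = ≤-trans C≤B (subst (_≤ B′ * B′) (*-identityʳ B′) (*-monoˡ-≤ B′ (fromℕ-nonNeg B) (≤-trans 1≤C C≤B)))
    fromℕk : fromℕ k ≡ (1# + 1#) * (B′ * M)
    fromℕk = trans (fromℕ-+ (B ℕ.* m) _) (trans (cong₂ _+_ (fromℕ-* B m) (trans (cong fromℕ (ℕ.+-identityʳ (B ℕ.* m))) (fromℕ-* B m)))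
      (solve 1 (λ x → x :+ x := (:1 :+ :1) :* x) refl (B′ * M)))
    k²η : fromℕ k * fromℕ k * η ≡ B′ * B′ + B′ * B′
    k²η = trans (cong (λ z → z * z * η) fromℕk) (trans
      (solve 3 (λ B M η → (:1 :+ :1) :* (B :* M) :* ((:1 :+ :1) :* (B :* M)) :* η := (B :* B :+ B :* B) :* ((M :* M :+ M :* M) :* η)) refl B′ M η)
      (trans (cong ((B′ * B′ + B′ * B′) *_) η-inverse) (*-identityʳ _)))

lemma5p4 :
    (∀ ℓ → ExcludedMiddle ℓ) → (R : CompleteOrderedField) →
    let open CompleteOrderedField R renaming (Carrier to ℝ)
        open Regression R
    in
    (C ρ₀ : ℝ) → 1# ≤ C → 0# < ρ₀ → ρ₀ < 1# →
    (s : ℕ → ℕ) → IsLittleO-dlogd s →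
    ∃[ N ] (∀ d → N ℕ.≤ d → ∀ ρ → ρ₀ ≤ ρ → ρ ≤ 1# →
      (𝒟 : ProbabilityMeasure (Cube (s d))) (alg : Algorithm d (s d)) →
      Σ[ p ∈ Poly d ] Σ[ σ ∈ ℝ ] Σ[ adv ∈ Adversary (s d) p σ ]
        (0# < σ) ×
        ((ℙ : ProbabilityMeasure (Outcomes alg adv)) → IsJointLaw alg adv ρ 𝒟 ℙ →
          fromℕ 4 ⁻¹ < pr ℙ (Failure alg adv C)))
lemma5p4 em R C ρ₀ 1≤C 0<ρ₀ _ s s=o =
  -- The threshold depends on `C`, `ρ₀` and `s` only: `ρ` enters through 1 ≤ ρ₀ 2^(b+1) ≤ ρ 2^(b+1).
  let β , C≤2^β  = power-above C
      b , 1≤ρ₀2ᵇ = power-inverse 0<ρ₀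
      N , blocks = choose-blocks β (suc b) s s=o
  in N , λ d N≤d ρ ρ₀≤ρ ρ≤1 𝒟 alg →
  let μ , K , 0<K , few , average , degree = blocks d N≤d
      0<m = ℕ.m^n>0 2 μ
      open Game em R 0<m {2 ℕ.* (2 ℕ.^ β ℕ.* 2 ℕ.^ μ)} degree (s d)
      ε , fails = some-ε-fails alg (peak-tall (2 ℕ.^ β) (2 ℕ.^ μ) 0<m 1≤C C≤2^β)
        (≤-trans (proj₁ 0<ρ₀) ρ₀≤ρ) ρ≤1 {suc b} {K} (≤-trans 1≤ρ₀2ᵇ (*-monoʳ-≤ _ (fromℕ-nonNeg (2 ℕ.^ suc b)) ρ₀≤ρ)) 0<K few average 𝒟
  in poly ε , 1# , adversary alg ε , 0<1 , fails
  where
  open RealField em R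
  open Parameters em R
  open Asymptotics em R
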